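{- Let $G$ be a graph with $n$ vertices, let $A$ be its adjacency matrix and $A_1$ the adjacency matrix of its line graph $L_1(G)$, and write $\det(xI_n-L(G))=\sum_{k=0}^n(-1)^{n-k}c_kx^k$. Then: (1) $c_{n-1}(G)=\operatorname{Tr}A^2$ and $c_{n-2}(G)=\frac12\big[\prod_{i=0}^1(\operatorname{Tr}A^2-2i)-\operatorname{Tr}A_1^2\big]$. (2) $c_{n-3}(G)=\frac{1}{3!}\big[\prod_{i=0}^2(\operatorname{Tr}A^2-2i)-3\operatorname{Tr}A^2\operatorname{Tr}A_1^2+\operatorname{Tr}(12A_1^2+2A_1^3)-4\operatorname{Tr}A^3\big]$. (3) If $G$ is a forest, $c_{n-4}(G)=\frac{1}{4!}\big[\prod_{i=0}^3(\operatorname{Tr}A^2-2i)-6(\operatorname{Tr}A^2)^2\operatorname{Tr}A_1^2+\operatorname{Tr}A^2\operatorname{Tr}(60A_1^2+8A_1^3)-\operatorname{Tr}(144A_1^2+48A_1^3+6A_1^4)+3(\operatorname{Tr}A_1^2)^2\big]$. (4) If $G$ is a forest, $c_{n-5}(G)=\frac{1}{5!}\big[\prod_{i=0}^4(\operatorname{Tr}A^2-2i)-10(\operatorname{Tr}A^2)^3\operatorname{Tr}A_1^2+(\operatorname{Tr}A^2)^2\operatorname{Tr}(180A_1^2+20A_1^3)-\operatorname{Tr}A^2\operatorname{Tr}(1040A_1^2+280A_1^3+30A_1^4)+15\operatorname{Tr}A^2(\operatorname{Tr}A_1^2)^2-\operatorname{Tr}A_1^2\operatorname{Tr}(120A_1^2+20A_1^3)+\operatorname{Tr}(1920A_1^2+960A_1^3+240A_1^4+24A_1^5)\big]$.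 (5) If $G$ is a forest, $c_{n-6}(G)=\frac{1}{6!}\big[\prod_{i=0}^5(\operatorname{Tr}A^2-2i)-15(\operatorname{Tr}A^2)^4\operatorname{Tr}A_1^2+(\operatorname{Tr}A^2)^3\operatorname{Tr}(420A_1^2+40A_1^3)-(\operatorname{Tr}A^2)^2\operatorname{Tr}(4260A_1^2+960A_1^3+90A_1^4)+45(\operatorname{Tr}A^2\operatorname{Tr}A_1^2)^2-810\operatorname{Tr}A^2(\operatorname{Tr}A_1^2)^2+\operatorname{Tr}A^2\operatorname{Tr}(18480A_1^2+7520A_1^3+1620A_1^4+144A_1^5)-15(\operatorname{Tr}A_1^2)^3+3600(\operatorname{Tr}A_1^2)^2-28800\operatorname{Tr}A_1^2+\operatorname{Tr}A_1^2\operatorname{Tr}(1200A_1^3+90A_1^4)+40(\operatorname{Tr}A_1^3)^2-120\operatorname{Tr}A^2\operatorname{Tr}A_1^2\operatorname{Tr}A_1^3-\operatorname{Tr}(19200A_1^3-7200A_1^4-1440A_1^5-120A_1^6)\big]$.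
   Context: $L(G)$ is the Laplacian matrix (degree matrix minus adjacency matrix). The line graph $L_1(G)$ has vertex set $E(G)$, two edges being adjacent iff they share an endpoint. $\operatorname{Tr}$ denotes trace (so $\operatorname{Tr}A^k$ is the number of closed walks of length $k$ in $G$).
   Formalization: In part (5) the last term is corrected to −Tr(19200A₁³+7200A₁⁴+1440A₁⁵+120A₁⁶); with the printed minus signs the formula fails, e.g. for the path on three vertices plus three isolated vertices (c₀=0, but the printed bracket is 29280). -}

module Defs where

open import Data.Nat as ℕ using (ℕ; zero; suc; _<ᵇ_)
open import Data.Integer using (ℤ; +_; -_; _+_; _*_; _-_)
open import Data.Fin using (Fin; zero; suc; inject₁; fromℕ; toℕ; punchIn)
import Data.Fin as Fin
open import Data.Bool using (Bool; true; false; if_then_else_; _∧_; _∨_; not)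
open import Data.List using (List; []; _∷_; map; length; lookup; filterᵇ; concatMap; allFin)
open import Data.Product using (_×_; _,_)
open import Relation.Nullary using (¬_)
open import Relation.Nullary.Decidable using (⌊_⌋)
open import Relation.Binary.PropositionalEquality using (_≡_)

-- Univariate integer polynomials as little-endian coefficient lists

Poly : Set
Poly = List ℤ

infixl 6 _⊕_
infixl 7 _⊗_

_⊕_ : Poly → Poly → Poly
[] ⊕ q = q
(a ∷ p) ⊕ [] = a ∷ p
(a ∷ p) ⊕ (b ∷ q) = (a + b) ∷ (p ⊕ q)

scale : ℤ → Poly → Poly
scale c = map (c *_)

_⊗_ : Poly → Poly → Poly
[] ⊗ q = []
(a ∷ p) ⊗ q = scale a q ⊕ (+ 0 ∷ (p ⊗ q))

constP : ℤ → Poly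
constP c = c ∷ []

xP : Poly
xP = + 0 ∷ + 1 ∷ []

coeff : Poly → ℕ → ℤ
coeff [] _ = + 0
coeff (a ∷ p) zero = a
coeff (a ∷ p) (suc k) = coeff p k

sgn : ℕ → ℤ
sgn zero = + 1
sgn (suc k) = - sgn k

sumPoly : ∀ {n} → (Fin n → Poly) → Poly
sumPoly {zero} f = []
sumPoly {suc n} f = f zero ⊕ sumPoly (λ i → f (suc i))

det : ∀ {n} → (Fin n → Fin n → Poly) → Poly
det {zero} M = constP (+ 1)
det {suc n} M =
  sumPoly (λ j → scale (sgn (toℕ j))
                       (M zero j ⊗ det (λ r c → M (suc r) (punchIn j c))))

Mat : ℕ → Set
Mat m = Fin m → Fin m → ℤ

sumℤ : ∀ {n} → (Fin n → ℤ) → ℤ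
sumℤ {zero} f = + 0
sumℤ {suc n} f = f zero + sumℤ (λ i → f (suc i))

_==_ : ∀ {n} → Fin n → Fin n → Bool
i == j = ⌊ i Fin.≟ j ⌋

idMat : ∀ {m} → Mat m
idMat i j = if i == j then + 1 else + 0

_·_ : ∀ {m} → Mat m → Mat m → Mat m
(M · N) i j = sumℤ (λ k → M i k * N k j)

matPow : ∀ {m} → Mat m → ℕ → Mat m
matPow M zero = idMat
matPow M (suc k) = M · matPow M k

Tr : ∀ {m} → Mat m → ℤ
Tr M = sumℤ (λ i → M i i)

record Graph (n : ℕ) : Set where
  field
    adj    : Fin n → Fin n → Bool
    sym    : ∀ i j → adj i j ≡ adj j i
    irrefl : ∀ i → adj i i ≡ false
open Graph public

b2ℤ : Bool → ℤ
b2ℤ true = + 1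
b2ℤ false = + 0

adjMat : ∀ {n} → Graph n → Mat n
adjMat G i j = b2ℤ (adj G i j)

degree : ∀ {n} → Graph n → Fin n → ℤ
degree G i = sumℤ (λ j → adjMat G i j)

laplacian : ∀ {n} → Graph n → Mat n
laplacian G i j = (if i == j then degree G i else + 0) - adjMat G i j

charPolyL : ∀ {n} → Graph n → Poly
charPolyL {n} G =
  det (λ i j → (if i == j then xP else []) ⊕ constP (- laplacian G i j))

-- c_k(G), defined by det(xI - L(G)) = Σ_k (-1)^(n-k) c_k x^k
c : ∀ {n} → Graph n → ℕ → ℤ
c {n} G k = sgn (n ℕ.∸ k) * coeff (charPolyL G) k

-- Line graph L₁(G): vertices are the edges {i,j} (listed as pairs
-- (i , j) with i < j), adjacent iff distinct and sharing an endpoint.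

edgeList : ∀ {n} → Graph n → List (Fin n × Fin n)
edgeList {n} G =
  filterᵇ (λ { (i , j) → (toℕ i <ᵇ toℕ j) ∧ adj G i j })
          (concatMap (λ i → map (λ j → (i , j)) (allFin n)) (allFin n))

numEdges : ∀ {n} → Graph n → ℕ
numEdges G = length (edgeList G)

shareEnd : ∀ {n} → Fin n × Fin n → Fin n × Fin n → Bool
shareEnd (a , b) (a' , b') = (a == a') ∨ (a == b') ∨ (b == a') ∨ (b == b')

lineAdj : ∀ {n} (G : Graph n) → Fin (numEdges G) → Fin (numEdges G) → Bool
lineAdj G e f = not (e == f) ∧ shareEnd (lookup (edgeList G) e) (lookup (edgeList G) f)

lineAdjMat : ∀ {n} (G : Graph n) → Mat (numEdges G)
lineAdjMat G e f = b2ℤ (lineAdj G e f)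

record Cycle {n} (G : Graph n) : Set where
  field
    len₋₃ : ℕ
    v     : Fin (3 ℕ.+ len₋₃) → Fin n
    inj   : ∀ i j → v i ≡ v j → i ≡ j
    step  : ∀ (i : Fin (2 ℕ.+ len₋₃)) → adj G (v (inject₁ i)) (v (suc i)) ≡ true
    close : adj G (v (fromℕ (2 ℕ.+ len₋₃))) (v zero) ≡ true

Forest : ∀ {n} → Graph n → Set
Forest G = ¬ Cycle G

fallProd : ℤ → ℕ → ℤ
fallProd t zero = + 1
fallProd t (suc k) = fallProd t k * (t - + (2 ℕ.* k))

trA : ∀ {n} → Graph n → ℕ → ℤ
trA G k = Tr (matPow (adjMat G) k)

trA₁ : ∀ {n} → Graph n → ℕ → ℤ
trA₁ G k = Tr (matPow (lineAdjMat G) k)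

{-# OPTIONS --safe #-}

-- With χ = det (xI − M) and B = adj (xI − M), the identities (xI − M) B = χ I and
-- Tr B = χ′ determine the coefficient matrices of B by a recursion, and taking
-- traces of its products with powers of M gives Newton's identities between the
-- coefficients of χ and the power sums Tr Mᵏ. For M = L(G) = D − A, the power sums
-- differ from those of Q = D + A only by the words in D and A with an odd number of
-- factors A; their traces count closed walks of odd length, so they vanish for forests,
-- while in general only Tr A³ matters up to k = 3. Finally Q = R Rᵀ and
-- Rᵀ R = 2I + A₁ for the vertex-edge incidence matrix R, whence
-- Tr Qᵏ = Tr (2I + A₁)ᵏ, and 2 |E| = Tr A².
--
-- Identities of polynomials are proved by evaluating at integers, so that
-- all determinant theory takes place over ℤ.

module Submission where

open import Defs hiding (sym)
open import Data.Nat as ℕ using (ℕ; zero; suc; _≤_; _∸_; _<ᵇ_)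
import Data.Nat.Properties as ℕ
open import Data.Integer using (ℤ; +_; -_; _+_; _*_; _-_; ∣_∣)
import Data.Integer.Properties as ℤ
open import Data.Integer.Tactic.RingSolver using (solve-∀)
open import Data.Fin using (Fin; zero; suc; toℕ; fromℕ; inject₁; inject≤; punchIn)
import Data.Fin as Fin
import Data.Fin.Properties as Fin
open import Data.Bool using (Bool; true; false; if_then_else_; _∧_; not; T)
import Data.Bool.Properties as Bool
open import Data.List using (List; []; _∷_; _++_; length; map; lookup; filterᵇ; concatMap; cartesianProduct; tabulate; allFin)
open import Data.List.Properties using (length-map)
open import Data.List.Membership.Propositional.Properties using (∈-lookup)
import Data.List.Relation.Unary.All as All
import Data.List.Relation.Unary.All.Properties as All
open import Data.List.Relation.Unary.AllPairs using (_∷_)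
open import Data.List.Relation.Unary.Unique.Propositional using (Unique)
import Data.List.Relation.Unary.Unique.Propositional.Properties as Unique
open import Data.Product using (_×_; _,_; proj₁; proj₂)
open import Function using (_∘_; const; Equivalence)
open import Relation.Nullary using (¬_; yes; no; contradiction)
open import Relation.Binary.Definitions using (tri<; tri≈; tri>)
open import Relation.Binary.PropositionalEquality


+-congˡ : ∀ x {y z} → y ≡ z → x + y ≡ x + z
+-congˡ x refl = refl

sum-cong : ∀ {n} {f g : Fin n → ℤ} → (∀ i → f i ≡ g i) → sumℤ f ≡ sumℤ g
sum-cong {zero}  eq = refl
sum-cong {suc n} eq = cong₂ _+_ (eq zero) (sum-cong (eq ∘ suc))

sum-zero : ∀ {n} {f : Fin n → ℤ} → (∀ i → f i ≡ + 0) → sumℤ f ≡ + 0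
sum-zero {zero}  eq = refl
sum-zero {suc n} eq = cong₂ _+_ (eq zero) (sum-zero (eq ∘ suc))

interchange : ∀ a b c d → (a + b) + (c + d) ≡ (a + c) + (b + d)
interchange = solve-∀

sum-+ : ∀ {n} (f g : Fin n → ℤ) → sumℤ (λ i → f i + g i) ≡ sumℤ f + sumℤ g
sum-+ {zero}  f g = refl
sum-+ {suc n} f g = trans (+-congˡ (f zero + g zero) (sum-+ (f ∘ suc) (g ∘ suc)))
  (interchange (f zero) (g zero) (sumℤ (f ∘ suc)) (sumℤ (g ∘ suc)))

sum-*ˡ : ∀ {n} a (f : Fin n → ℤ) → a * sumℤ f ≡ sumℤ (λ i → a * f i)
sum-*ˡ {zero}  a f = ℤ.*-zeroʳ a
sum-*ˡ {suc n} a f = trans (ℤ.*-distribˡ-+ a (f zero) _) (+-congˡ (a * f zero) (sum-*ˡ a (f ∘ suc)))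

sum-*ʳ : ∀ {n} (f : Fin n → ℤ) a → sumℤ f * a ≡ sumℤ (λ i → f i * a)
sum-*ʳ f a = trans (ℤ.*-comm _ a) (trans (sum-*ˡ a f) (sum-cong λ i → ℤ.*-comm a (f i)))

sum-neg : ∀ {n} (f : Fin n → ℤ) → sumℤ (λ i → - f i) ≡ - sumℤ f
sum-neg {zero}  f = refl
sum-neg {suc n} f = trans (+-congˡ (- f zero) (sum-neg (f ∘ suc))) (sym (ℤ.neg-distrib-+ (f zero) (sumℤ (f ∘ suc))))

sum-swap : ∀ {m n} (f : Fin m → Fin n → ℤ) →
  sumℤ (λ i → sumℤ (λ j → f i j)) ≡ sumℤ (λ j → sumℤ (λ i → f i j))
sum-swap {zero} {n} f = sym (sum-zero {n} {λ j → + 0} λ j → refl)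
sum-swap {suc m} f = trans (+-congˡ (sumℤ (f zero)) (sum-swap (f ∘ suc)))
  (sym (sum-+ (f zero) (λ j → sumℤ (λ i → f (suc i) j))))

==-refl : ∀ {n} (i : Fin n) → (i == i) ≡ true
==-refl i with i Fin.≟ i
... | yes _ = refl
... | no ne = contradiction refl ne

==-≢ : ∀ {n} {i j : Fin n} → i ≢ j → (i == j) ≡ false
==-≢ {i = i} {j} ne with i Fin.≟ j
... | yes eq = contradiction eq ne
... | no _   = refl

==-suc : ∀ {n} (i j : Fin n) → (suc i == suc j) ≡ (i == j)
==-suc i j with i Fin.≟ j
... | yes _ = refl
... | no _  = refl

idMat-refl : ∀ {n} (i : Fin n) → idMat i i ≡ + 1
idMat-refl i rewrite ==-refl i = refl

idMat-≢ : ∀ {n} {i j : Fin n} → i ≢ j → idMat i j ≡ + 0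
idMat-≢ ne rewrite ==-≢ ne = refl

idMat-suc : ∀ {n} (i j : Fin n) → idMat (suc i) (suc j) ≡ idMat i j
idMat-suc i j rewrite ==-suc i j = refl

idMat-sym : ∀ {n} (i j : Fin n) → idMat i j ≡ idMat j i
idMat-sym i j with i Fin.≟ j
... | yes refl = sym (idMat-refl i)
... | no ne    = sym (idMat-≢ (ne ∘ sym))

sum-idMatˡ : ∀ {n} (i : Fin n) (f : Fin n → ℤ) → sumℤ (λ j → idMat i j * f j) ≡ f i
sum-idMatˡ zero f =
  trans (cong₂ _+_ (ℤ.*-identityˡ (f zero)) (sum-zero λ j → ℤ.*-zeroˡ (f (suc j)))) (ℤ.+-identityʳ _)
sum-idMatˡ (suc i) f =
  trans (cong₂ _+_ (ℤ.*-zeroˡ (f zero))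
          (trans (sum-cong λ j → cong (_* f (suc j)) (idMat-suc i j)) (sum-idMatˡ i (f ∘ suc))))
        (ℤ.+-identityˡ _)

sum-idMatʳ : ∀ {n} (i : Fin n) (f : Fin n → ℤ) → sumℤ (λ j → f j * idMat j i) ≡ f i
sum-idMatʳ i f =
  trans (sum-cong λ j → trans (ℤ.*-comm (f j) _) (cong (_* f j) (idMat-sym j i))) (sum-idMatˡ i f)

Matrix : ℕ → ℕ → Set
Matrix m n = Fin m → Fin n → ℤ

infix 4 _≋_
_≋_ : ∀ {m n} → Matrix m n → Matrix m n → Set
M ≋ N = ∀ i j → M i j ≡ N i j

≋-sym : ∀ {m n} {M N : Matrix m n} → M ≋ N → N ≋ M
≋-sym p i j = sym (p i j)

infixr 4 _⟫_
_⟫_ : ∀ {m n} {M N P : Matrix m n} → M ≋ N → N ≋ P → M ≋ P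
(p ⟫ q) i j = trans (p i j) (q i j)

infixr 7 _⊙_
_⊙_ : ∀ {l m n} → Matrix l m → Matrix m n → Matrix l n
(M ⊙ N) i j = sumℤ (λ k → M i k * N k j)

⊙-cong : ∀ {l m n} {M M′ : Matrix l m} {N N′ : Matrix m n} → M ≋ M′ → N ≋ N′ → M ⊙ N ≋ M′ ⊙ N′
⊙-cong p q i j = sum-cong λ k → cong₂ _*_ (p i k) (q k j)

⊙-congˡ : ∀ {l m n} (M : Matrix l m) {N N′ : Matrix m n} → N ≋ N′ → M ⊙ N ≋ M ⊙ N′
⊙-congˡ M = ⊙-cong {M = M} λ _ _ → refl

⊙-congʳ : ∀ {l m n} {M M′ : Matrix l m} (N : Matrix m n) → M ≋ M′ → M ⊙ N ≋ M′ ⊙ N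
⊙-congʳ N p = ⊙-cong {N = N} p λ _ _ → refl

⊙-assoc : ∀ {k l m n} (M : Matrix k l) (N : Matrix l m) (P : Matrix m n) → (M ⊙ N) ⊙ P ≋ M ⊙ (N ⊙ P)
⊙-assoc M N P i j = begin
  sumℤ (λ b → sumℤ (λ a → M i a * N a b) * P b j)
    ≡⟨ sum-cong (λ b → sum-*ʳ (λ a → M i a * N a b) (P b j)) ⟩
  sumℤ (λ b → sumℤ (λ a → M i a * N a b * P b j))
    ≡⟨ sum-swap (λ b a → M i a * N a b * P b j) ⟩
  sumℤ (λ a → sumℤ (λ b → M i a * N a b * P b j))
    ≡⟨ sum-cong (λ a → trans (sum-cong λ b → ℤ.*-assoc (M i a) (N a b) (P b j)) (sym (sum-*ˡ (M i a) (λ b → N a b * P b j)))) ⟩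
  sumℤ (λ a → M i a * sumℤ (λ b → N a b * P b j)) ∎
  where open ≡-Reasoning

⊙-identityˡ : ∀ {m n} (M : Matrix m n) → idMat ⊙ M ≋ M
⊙-identityˡ M i j = sum-idMatˡ i (λ k → M k j)

⊙-identityʳ : ∀ {m n} (M : Matrix m n) → M ⊙ idMat ≋ M
⊙-identityʳ M i j = sum-idMatʳ j (M i)

Tr-cong : ∀ {n} {M N : Mat n} → M ≋ N → Tr M ≡ Tr N
Tr-cong p = sum-cong λ i → p i i

Tr-comm : ∀ {m n} (M : Matrix m n) (N : Matrix n m) → Tr (M ⊙ N) ≡ Tr (N ⊙ M)
Tr-comm M N = trans (sum-swap λ i k → M i k * N k i) (sum-cong λ k → sum-cong λ i → ℤ.*-comm (M i k) (N k i))

Tr-idMat : ∀ {n} → Tr (idMat {n}) ≡ + n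
Tr-idMat {zero}  = refl
Tr-idMat {suc n} = +-congˡ (+ 1) (trans (sum-cong {n} λ i → idMat-suc i i) (Tr-idMat {n}))

matPow-cong : ∀ {n} {M N : Mat n} → M ≋ N → ∀ k → matPow M k ≋ matPow N k
matPow-cong p zero    i j = refl
matPow-cong p (suc k) = ⊙-cong p (matPow-cong p k)

matPow-intertwine : ∀ {m n} (U : Matrix m n) (V : Matrix n m) k →
  matPow (U ⊙ V) k ⊙ U ≋ U ⊙ matPow (V ⊙ U) k
matPow-intertwine U V zero = ⊙-identityˡ U ⟫ ≋-sym (⊙-identityʳ U)
matPow-intertwine U V (suc k) =
  ⊙-assoc (U ⊙ V) (matPow (U ⊙ V) k) U
  ⟫ ⊙-congˡ (U ⊙ V) (matPow-intertwine U V k)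
  ⟫ ⊙-assoc U V (U ⊙ matPow (V ⊙ U) k)
  ⟫ ⊙-congˡ U (≋-sym (⊙-assoc V U (matPow (V ⊙ U) k)))

Tr-matPow-comm : ∀ {m n} (U : Matrix m n) (V : Matrix n m) k →
  Tr (matPow (U ⊙ V) (suc k)) ≡ Tr (matPow (V ⊙ U) (suc k))
Tr-matPow-comm U V k = begin
  Tr ((U ⊙ V) ⊙ P)    ≡⟨ Tr-cong (⊙-assoc U V P) ⟩
  Tr (U ⊙ (V ⊙ P))    ≡⟨ Tr-comm U (V ⊙ P) ⟩
  Tr ((V ⊙ P) ⊙ U)    ≡⟨ Tr-cong (⊙-assoc V P U) ⟩
  Tr (V ⊙ (P ⊙ U))    ≡⟨ Tr-cong (⊙-congˡ V (matPow-intertwine U V k)) ⟩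
  Tr (V ⊙ (U ⊙ P′))   ≡⟨ Tr-cong (⊙-assoc V U P′) ⟨
  Tr ((V ⊙ U) ⊙ P′)   ∎
  where
  open ≡-Reasoning
  P  = matPow (U ⊙ V) k
  P′ = matPow (V ⊙ U) k

matPow-sucʳ : ∀ {n} (M : Mat n) k → matPow M k ⊙ M ≋ matPow M (suc k)
matPow-sucʳ M zero = ⊙-identityˡ M ⟫ ≋-sym (⊙-identityʳ M)
matPow-sucʳ M (suc k) = ⊙-assoc M (matPow M k) M ⟫ ⊙-congˡ M (matPow-sucʳ M k)

-- Determinants of integer matrices

detℤ : ∀ {n} → Mat n → ℤ
detℤ {zero}  M = + 1
detℤ {suc n} M = sumℤ (λ j → sgn (toℕ j) * (M zero j * detℤ (λ r c → M (suc r) (punchIn j c))))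

detℤ-cong : ∀ {n} {M N : Mat n} → M ≋ N → detℤ M ≡ detℤ N
detℤ-cong {zero}  p = refl
detℤ-cong {suc n} p = sum-cong λ j →
  cong (sgn (toℕ j) *_) (cong₂ _*_ (p zero j) (detℤ-cong λ r c → p (suc r) (punchIn j c)))

setRow : ∀ {A : Set} {n} → (Fin n → A) → Fin n → A → Fin n → A
setRow M zero    v zero    = v
setRow M zero    v (suc r) = M (suc r)
setRow M (suc i) v zero    = M zero
setRow M (suc i) v (suc r) = setRow (M ∘ suc) i v r

setRow-map : ∀ {A B : Set} {n} (f : A → B) (M : Fin n → A) i v r →
  f (setRow M i v r) ≡ setRow (f ∘ M) i (f v) r
setRow-map f M zero    v zero    = refl
setRow-map f M zero    v (suc r) = refl
setRow-map f M (suc i) v zero    = refl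
setRow-map f M (suc i) v (suc r) = setRow-map f (M ∘ suc) i v r

setRow-updates : ∀ {A : Set} {n} (M : Fin n → A) i v → setRow M i v i ≡ v
setRow-updates M zero    v = refl
setRow-updates M (suc i) v = setRow-updates (M ∘ suc) i v

setRow-minimal : ∀ {A : Set} {n} (M : Fin n → A) i v r → r ≢ i → setRow M i v r ≡ M r
setRow-minimal M zero    v zero    ne = contradiction refl ne
setRow-minimal M zero    v (suc r) ne = refl
setRow-minimal M (suc i) v zero    ne = refl
setRow-minimal M (suc i) v (suc r) ne = setRow-minimal (M ∘ suc) i v r (ne ∘ cong suc)

setRow-self : ∀ {A : Set} {n} (M : Fin n → A) i r → setRow M i (M i) r ≡ M r
setRow-self M zero    zero    = refl
setRow-self M zero    (suc r) = refl
setRow-self M (suc i) zero    = refl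
setRow-self M (suc i) (suc r) = setRow-self (M ∘ suc) i r

setRow-minor : ∀ {A : Set} {n m l} (M : Fin n → Fin m → A) i v (g : Fin l → Fin m) r c →
  setRow M i v r (g c) ≡ setRow (λ r c → M r (g c)) i (v ∘ g) r c
setRow-minor M i v g r c = cong (λ h → h c) (setRow-map (_∘ g) M i v r)

setRow-cong : ∀ {n m} {M N : Matrix n m} i {v w} → M ≋ N → (∀ c → v c ≡ w c) → setRow M i v ≋ setRow N i w
setRow-cong zero    p q zero    c = q c
setRow-cong zero    p q (suc r) c = p (suc r) c
setRow-cong (suc i) p q zero    c = p zero c
setRow-cong (suc i) p q (suc r) c = setRow-cong i (p ∘ suc) q r c

detℤ-setRow-sum : ∀ {n m} (M : Mat n) i (a : Fin m → ℤ) (V : Matrix m n) →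
  detℤ (setRow M i (λ c → sumℤ (λ k → a k * V k c))) ≡ sumℤ (λ k → a k * detℤ (setRow M i (V k)))
detℤ-setRow-sum {suc n} {m} M zero a V = begin
  sumℤ (λ j → s j * (sumℤ (λ k → a k * V k j) * D j))
    ≡⟨ sum-cong (λ j → trans (cong (s j *_) (sum-*ʳ (λ k → a k * V k j) (D j))) (sum-*ˡ (s j) (λ k → a k * V k j * D j))) ⟩
  sumℤ (λ j → sumℤ (λ k → s j * (a k * V k j * D j)))
    ≡⟨ sum-cong (λ j → sum-cong λ k → lemma (s j) (a k) (V k j) (D j)) ⟩
  sumℤ (λ j → sumℤ (λ k → a k * (s j * (V k j * D j))))
    ≡⟨ sum-swap (λ j k → a k * (s j * (V k j * D j))) ⟩
  sumℤ (λ k → sumℤ (λ j → a k * (s j * (V k j * D j))))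
    ≡⟨ sum-cong (λ k → sum-*ˡ (a k) (λ j → s j * (V k j * D j))) ⟨
  sumℤ (λ k → a k * sumℤ (λ j → s j * (V k j * D j))) ∎
  where
  open ≡-Reasoning
  s : Fin (suc n) → ℤ
  s j = sgn (toℕ j)
  D : Fin (suc n) → ℤ
  D j = detℤ (λ r c → M (suc r) (punchIn j c))
  lemma : ∀ s a v d → s * (a * v * d) ≡ a * (s * (v * d))
  lemma = solve-∀
detℤ-setRow-sum {suc n} {m} M (suc i) a V = begin
  sumℤ (λ j → s j * (M zero j * detℤ (λ r c → setRow (M ∘ suc) i v r (punchIn j c))))
    ≡⟨ sum-cong (λ j → cong (λ x → s j * (M zero j * x))
         (trans (detℤ-cong (setRow-minor (M ∘ suc) i v (punchIn j)))
                (detℤ-setRow-sum (λ r c → M (suc r) (punchIn j c)) i a (λ k → V k ∘ punchIn j)))) ⟩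
  sumℤ (λ j → s j * (M zero j * sumℤ (λ k → a k * D j k)))
    ≡⟨ sum-cong (λ j → trans (cong (s j *_) (sum-*ˡ (M zero j) (λ k → a k * D j k))) (sum-*ˡ (s j) (λ k → M zero j * (a k * D j k)))) ⟩
  sumℤ (λ j → sumℤ (λ k → s j * (M zero j * (a k * D j k))))
    ≡⟨ sum-cong (λ j → sum-cong λ k → lemma (s j) (M zero j) (a k) (D j k)) ⟩
  sumℤ (λ j → sumℤ (λ k → a k * (s j * (M zero j * D j k))))
    ≡⟨ sum-swap (λ j k → a k * (s j * (M zero j * D j k))) ⟩
  sumℤ (λ k → sumℤ (λ j → a k * (s j * (M zero j * D j k))))
    ≡⟨ sum-cong (λ k → sum-*ˡ (a k) (λ j → s j * (M zero j * D j k))) ⟨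
  sumℤ (λ k → a k * sumℤ (λ j → s j * (M zero j * D j k)))
    ≡⟨ sum-cong (λ k → cong (a k *_) (sum-cong λ j → cong (λ x → s j * (M zero j * x))
         (sym (detℤ-cong (setRow-minor (M ∘ suc) i (V k) (punchIn j)))))) ⟩
  sumℤ (λ k → a k * detℤ (setRow M (suc i) (V k))) ∎
  where
  open ≡-Reasoning
  s : Fin (suc n) → ℤ
  s j = sgn (toℕ j)
  v : Fin (suc n) → ℤ
  v c = sumℤ (λ k → a k * V k c)
  D : Fin (suc n) → Fin m → ℤ
  D j k = detℤ (setRow (λ r c → M (suc r) (punchIn j c)) i (V k ∘ punchIn j))
  lemma : ∀ s x a d → s * (x * (a * d)) ≡ a * (s * (x * d))
  lemma = solve-∀

-- Laplace expansion along the first two rows u and v, where E sends the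
-- enumeration of the remaining columns to the complementary minor.
expand₂ : ∀ {n} (u v : Fin (2 ℕ.+ n) → ℤ) (E : (Fin n → Fin (2 ℕ.+ n)) → ℤ) → ℤ
expand₂ u v E = sumℤ (λ j → sgn (toℕ j) * (u j *
  sumℤ (λ k → sgn (toℕ k) * (v (punchIn j k) * E (λ c → punchIn j (punchIn k c))))))

lift : ∀ {m n} → (Fin m → Fin n) → Fin (suc m) → Fin (suc n)
lift f zero    = zero
lift f (suc i) = suc (f i)

expand₂-zero : ∀ {n} (u v : Fin (2 ℕ.+ n) → ℤ) (E : (Fin n → Fin (2 ℕ.+ n)) → ℤ) → ℤ
expand₂-zero u v E = sumℤ (λ k → sgn (toℕ k) * (u zero * (v (suc k) * E (λ c → suc (punchIn k c)))))

-- Splitting off column 0 leaves the same expansion with one column less.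
expand₂-split : ∀ {n} (u v : Fin (3 ℕ.+ n) → ℤ) (E : (Fin (suc n) → Fin (3 ℕ.+ n)) → ℤ) → (∀ {f g} → (∀ c → f c ≡ g c) → E f ≡ E g) →
  expand₂ u v E ≡ (expand₂-zero u v E - expand₂-zero v u E)
                  + expand₂ (u ∘ suc) (v ∘ suc) (λ f → E (lift f))
expand₂-split {n} u v E E-cong = begin
  + 1 * (u zero * sumℤ (λ k → s k * (v (suc k) * e k)))
    + sumℤ (λ j → - s j * (u (suc j) * (+ 1 * (v zero * e j)
        + sumℤ (λ k → - s k * (v (suc (punchIn j k)) * E (λ c → punchIn (suc j) (punchIn (suc k) c)))))))
    ≡⟨ cong₂ _+_ (trans (ℤ.*-identityˡ (u zero * sumℤ (λ k → s k * (v (suc k) * e k)))) (trans (sum-*ˡ (u zero) (λ k → s k * (v (suc k) * e k)))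
                    (sum-cong λ k → flip₃ (u zero) (s k) (v (suc k) * e k))))
                 (sum-cong λ j → trans (cong (λ x → - s j * (u (suc j) * (+ 1 * (v zero * e j) + x))) (inner j))
                                       (outer (s j) (u (suc j)) (v zero) (e j) (S j))) ⟩
  expand₂-zero u v E + sumℤ (λ j → - (s j * (v zero * (u (suc j) * e j))) + s j * (u (suc j) * S j))
    ≡⟨ +-congˡ (expand₂-zero u v E) (sum-+ (λ j → - (s j * (v zero * (u (suc j) * e j)))) (λ j → s j * (u (suc j) * S j))) ⟩
  expand₂-zero u v E + (sumℤ (λ j → - (s j * (v zero * (u (suc j) * e j)))) + X)
    ≡⟨ cong (λ x → expand₂-zero u v E + (x + X)) (sum-neg λ j → s j * (v zero * (u (suc j) * e j))) ⟩
  expand₂-zero u v E + (- expand₂-zero v u E + X)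
    ≡⟨ ℤ.+-assoc (expand₂-zero u v E) (- expand₂-zero v u E) X ⟨
  (expand₂-zero u v E - expand₂-zero v u E) + X ∎
  where
  open ≡-Reasoning
  s : ∀ {m} → Fin m → ℤ
  s j = sgn (toℕ j)
  e : Fin (2 ℕ.+ n) → ℤ
  e k = E (λ c → suc (punchIn k c))
  S : Fin (2 ℕ.+ n) → ℤ
  S j = sumℤ (λ k → s k * (v (suc (punchIn j k)) * E (lift (λ c → punchIn j (punchIn k c)))))
  X : ℤ
  X = expand₂ (u ∘ suc) (v ∘ suc) (λ f → E (lift f))
  flip₃ : ∀ a b c → a * (b * c) ≡ b * (a * c)
  flip₃ = solve-∀
  outer : ∀ s u v e S → - s * (u * (+ 1 * (v * e) + - S)) ≡ - (s * (v * (u * e))) + s * (u * S)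
  outer = solve-∀
  negˡ : ∀ s x → - s * x ≡ - (s * x)
  negˡ = solve-∀
  inner : ∀ j → sumℤ (λ k → - s k * (v (suc (punchIn j k)) * E (λ c → punchIn (suc j) (punchIn (suc k) c)))) ≡ - S j
  inner j = trans (sum-cong λ k → trans (negˡ (s k) (v (suc (punchIn j k)) * E (λ c → punchIn (suc j) (punchIn (suc k) c))))
                    (cong (λ x → - (s k * (v (suc (punchIn j k)) * x)))
                    (E-cong {λ c → punchIn (suc j) (punchIn (suc k) c)} {lift (λ c → punchIn j (punchIn k c))}
                      λ { zero → refl ; (suc c) → refl })))
                  (sum-neg λ k → s k * (v (suc (punchIn j k)) * E (lift (λ c → punchIn j (punchIn k c)))))

expand₂-antisym : ∀ {n} (u v : Fin (2 ℕ.+ n) → ℤ) (E : (Fin n → Fin (2 ℕ.+ n)) → ℤ) → (∀ {f g} → (∀ c → f c ≡ g c) → E f ≡ E g) →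
  expand₂ u v E + expand₂ v u E ≡ + 0
expand₂-antisym {zero} u v E E-cong =
  trans (cong (λ e → two (u zero) (u (suc zero)) (v zero) (v (suc zero)) (E (λ c → suc (suc c))) e
                   + two (v zero) (v (suc zero)) (u zero) (u (suc zero)) (E (λ c → suc (suc c))) e) (E-cong λ ()))
        (lemma (u zero) (u (suc zero)) (v zero) (v (suc zero)) (E (λ c → suc (suc c))))
  where
  two : ℤ → ℤ → ℤ → ℤ → ℤ → ℤ → ℤ
  two a b c d e e′ = + 1 * (a * (+ 1 * (d * e) + + 0)) + (- + 1 * (b * (+ 1 * (c * e′) + + 0)) + + 0)
  lemma : ∀ a b c d e →
    (+ 1 * (a * (+ 1 * (d * e) + + 0)) + (- + 1 * (b * (+ 1 * (c * e) + + 0)) + + 0)) +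
    (+ 1 * (c * (+ 1 * (b * e) + + 0)) + (- + 1 * (d * (+ 1 * (a * e) + + 0)) + + 0)) ≡ + 0
  lemma = solve-∀
expand₂-antisym {suc n} u v E E-cong =
  trans (cong₂ _+_ (expand₂-split u v E E-cong) (expand₂-split v u E E-cong))
  (trans (cancel (expand₂-zero u v E) (expand₂-zero v u E)
    (expand₂ (u ∘ suc) (v ∘ suc) (λ f → E (lift f))) (expand₂ (v ∘ suc) (u ∘ suc) (λ f → E (lift f))))
         (expand₂-antisym (u ∘ suc) (v ∘ suc) (λ f → E (lift f))
           λ p → E-cong λ { zero → refl ; (suc c) → cong suc (p c) }))
  where
  cancel : ∀ a b x y → ((a - b) + x) + ((b - a) + y) ≡ x + y
  cancel = solve-∀

swap₀₁ : ∀ {A : Set} {n} → (Fin (2 ℕ.+ n) → A) → Fin (2 ℕ.+ n) → A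
swap₀₁ M zero          = M (suc zero)
swap₀₁ M (suc zero)    = M zero
swap₀₁ M (suc (suc r)) = M (suc (suc r))

detℤ-swap₀₁ : ∀ {n} (M : Mat (2 ℕ.+ n)) → detℤ M + detℤ (swap₀₁ M) ≡ + 0
detℤ-swap₀₁ M = expand₂-antisym (M zero) (M (suc zero))
  (λ f → detℤ (λ r c → M (suc (suc r)) (f c)))
  (λ p → detℤ-cong λ r c → cong (M (suc (suc r))) (p c))

x+x≡0⇒x≡0 : ∀ x → x + x ≡ + 0 → x ≡ + 0
x+x≡0⇒x≡0 x eq = ℤ.*-cancelˡ-≡ (+ 2) x (+ 0) (trans (lemma x) eq)
  where
  lemma : ∀ x → + 2 * x ≡ x + x
  lemma = solve-∀

detℤ-alternating : ∀ {n} (M : Mat n) i k → i ≢ k → (∀ c → M i c ≡ M k c) → detℤ M ≡ + 0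
detℤ-alternating-zero : ∀ {n} (M : Mat (suc n)) k → (∀ c → M zero c ≡ M (suc k) c) → detℤ M ≡ + 0
detℤ-alternating-suc : ∀ {n} (M : Mat (suc n)) i k → i ≢ k → (∀ c → M (suc i) c ≡ M (suc k) c) → detℤ M ≡ + 0

detℤ-alternating M zero zero ne eq = contradiction refl ne
detℤ-alternating M (suc i) (suc k) ne eq = detℤ-alternating-suc M i k (ne ∘ cong suc) eq
detℤ-alternating M zero (suc k) ne eq = detℤ-alternating-zero M k eq
detℤ-alternating M (suc i) zero ne eq = detℤ-alternating-zero M i (sym ∘ eq)

detℤ-alternating-zero {suc n} M zero eq =
  x+x≡0⇒x≡0 _ (trans (+-congˡ (detℤ M) (detℤ-cong same)) (detℤ-swap₀₁ M))
  where
  same : M ≋ swap₀₁ M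
  same zero          c = eq c
  same (suc zero)    c = sym (eq c)
  same (suc (suc r)) c = refl
detℤ-alternating-zero {suc n} M (suc k) eq =
  trans (sym (ℤ.+-identityʳ _))
  (trans (+-congˡ (detℤ M) (sym (detℤ-alternating-suc (swap₀₁ M) zero (suc k) (λ ()) eq))) (detℤ-swap₀₁ M))

detℤ-alternating-suc M i k ne eq = sum-zero λ j →
  trans (cong (λ x → sgn (toℕ j) * (M zero j * x))
          (detℤ-alternating (λ r c → M (suc r) (punchIn j c)) i k ne (λ c → eq (punchIn j c))))
        (lemma (sgn (toℕ j)) (M zero j))
  where
  lemma : ∀ a b → a * (b * + 0) ≡ + 0
  lemma = solve-∀

-- Polynomials

eval : Poly → ℤ → ℤ
eval []      x = + 0
eval (a ∷ p) x = a + x * eval p x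

deriv : Poly → Poly
deriv []      = []
deriv (a ∷ p) = p ⊕ (+ 0 ∷ deriv p)

eval-⊕ : ∀ p q x → eval (p ⊕ q) x ≡ eval p x + eval q x
eval-⊕ []      q       x = sym (ℤ.+-identityˡ (eval q x))
eval-⊕ (a ∷ p) []      x = sym (ℤ.+-identityʳ (eval (a ∷ p) x))
eval-⊕ (a ∷ p) (b ∷ q) x rewrite eval-⊕ p q x = lemma a b x (eval p x) (eval q x)
  where
  lemma : ∀ a b x p q → a + b + x * (p + q) ≡ a + x * p + (b + x * q)
  lemma = solve-∀

eval-scale : ∀ a p x → eval (scale a p) x ≡ a * eval p x
eval-scale a []      x = sym (ℤ.*-zeroʳ a)
eval-scale a (b ∷ p) x rewrite eval-scale a p x = lemma a b x (eval p x)
  where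
  lemma : ∀ a b x p → a * b + x * (a * p) ≡ a * (b + x * p)
  lemma = solve-∀

eval-⊗ : ∀ p q x → eval (p ⊗ q) x ≡ eval p x * eval q x
eval-⊗ []      q x = sym (ℤ.*-zeroˡ (eval q x))
eval-⊗ (a ∷ p) q x rewrite eval-⊕ (scale a q) (+ 0 ∷ (p ⊗ q)) x | eval-scale a q x | eval-⊗ p q x =
  lemma a x (eval p x) (eval q x)
  where
  lemma : ∀ a x p q → a * q + (+ 0 + x * (p * q)) ≡ (a + x * p) * q
  lemma = solve-∀

eval-sumPoly : ∀ {n} (f : Fin n → Poly) x → eval (sumPoly f) x ≡ sumℤ (λ i → eval (f i) x)
eval-sumPoly {zero}  f x = refl
eval-sumPoly {suc n} f x =
  trans (eval-⊕ (f zero) (sumPoly (f ∘ suc)) x) (+-congˡ (eval (f zero) x) (eval-sumPoly (f ∘ suc) x))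

eval-det : ∀ {n} (M : Fin n → Fin n → Poly) x → eval (det M) x ≡ detℤ (λ i j → eval (M i j) x)
eval-det {zero}  M x = cong (λ y → + 1 + y) (ℤ.*-zeroʳ x)
eval-det {suc n} M x = trans (eval-sumPoly (λ j → scale (sgn (toℕ j)) (M zero j ⊗ det (minor j))) x)
  (sum-cong λ j → trans (eval-scale (sgn (toℕ j)) (M zero j ⊗ det (minor j)) x)
    (cong (sgn (toℕ j) *_) (trans (eval-⊗ (M zero j) (det (minor j)) x)
      (cong (eval (M zero j) x *_) (eval-det (minor j) x)))))
  where
  minor : Fin (suc n) → Fin n → Fin n → Poly
  minor j r c = M (suc r) (punchIn j c)

eval-deriv-∷ : ∀ a p x → eval (deriv (a ∷ p)) x ≡ eval p x + x * eval (deriv p) x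
eval-deriv-∷ a p x = trans (eval-⊕ p (+ 0 ∷ deriv p) x)
  (+-congˡ (eval p x) (ℤ.+-identityˡ (x * eval (deriv p) x)))

eval-deriv-⊕ : ∀ p q x → eval (deriv (p ⊕ q)) x ≡ eval (deriv p) x + eval (deriv q) x
eval-deriv-⊕ []      q       x = sym (ℤ.+-identityˡ (eval (deriv q) x))
eval-deriv-⊕ (a ∷ p) []      x = sym (ℤ.+-identityʳ (eval (deriv (a ∷ p)) x))
eval-deriv-⊕ (a ∷ p) (b ∷ q) x
  rewrite eval-deriv-∷ (a + b) (p ⊕ q) x | eval-deriv-∷ a p x | eval-deriv-∷ b q x
        | eval-⊕ p q x | eval-deriv-⊕ p q x =
  lemma x (eval p x) (eval q x) (eval (deriv p) x) (eval (deriv q) x)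
  where
  lemma : ∀ x p q p′ q′ → p + q + x * (p′ + q′) ≡ p + x * p′ + (q + x * q′)
  lemma = solve-∀

eval-deriv-scale : ∀ a p x → eval (deriv (scale a p)) x ≡ a * eval (deriv p) x
eval-deriv-scale a []      x = sym (ℤ.*-zeroʳ a)
eval-deriv-scale a (b ∷ p) x
  rewrite eval-deriv-∷ (a * b) (scale a p) x | eval-deriv-∷ b p x | eval-scale a p x | eval-deriv-scale a p x =
  lemma a x (eval p x) (eval (deriv p) x)
  where
  lemma : ∀ a x p p′ → a * p + x * (a * p′) ≡ a * (p + x * p′)
  lemma = solve-∀

eval-deriv-⊗ : ∀ p q x →
  eval (deriv (p ⊗ q)) x ≡ eval (deriv p) x * eval q x + eval p x * eval (deriv q) x
eval-deriv-⊗ []      q x = sym (cong₂ _+_ (ℤ.*-zeroˡ (eval q x)) (ℤ.*-zeroˡ (eval (deriv q) x)))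
eval-deriv-⊗ (a ∷ p) q x
  rewrite eval-deriv-⊕ (scale a q) (+ 0 ∷ (p ⊗ q)) x | eval-deriv-∷ (+ 0) (p ⊗ q) x | eval-deriv-∷ a p x
        | eval-deriv-scale a q x | eval-⊗ p q x | eval-deriv-⊗ p q x =
  lemma a x (eval p x) (eval q x) (eval (deriv p) x) (eval (deriv q) x)
  where
  lemma : ∀ a x p q p′ q′ →
    a * q′ + (p * q + x * (p′ * q + p * q′)) ≡ (p + x * p′) * q + (a + x * p) * q′
  lemma = solve-∀

eval-deriv-sumPoly : ∀ {n} (f : Fin n → Poly) x →
  eval (deriv (sumPoly f)) x ≡ sumℤ (λ i → eval (deriv (f i)) x)
eval-deriv-sumPoly {zero}  f x = refl
eval-deriv-sumPoly {suc n} f x = trans (eval-deriv-⊕ (f zero) (sumPoly (f ∘ suc)) x)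
  (+-congˡ (eval (deriv (f zero)) x) (eval-deriv-sumPoly (f ∘ suc) x))

eval-deriv-det : ∀ {n} (M : Fin n → Fin n → Poly) x → eval (deriv (det M)) x ≡
  sumℤ (λ i → detℤ (setRow (λ r c → eval (M r c) x) i (λ c → eval (deriv (M i c)) x)))
eval-deriv-det {zero}  M x = cong (λ y → + 0 + y) (ℤ.*-zeroʳ x)
eval-deriv-det {suc n} M x = begin
  eval (deriv (det M)) x
    ≡⟨ eval-deriv-sumPoly (λ j → scale (s j) (M zero j ⊗ det (minor j))) x ⟩
  sumℤ (λ j → eval (deriv (scale (s j) (M zero j ⊗ det (minor j)))) x)
    ≡⟨ sum-cong expandTerm ⟩
  sumℤ (λ j → s j * (D zero j * detℤ (minorE j)) + sumℤ (λ i → s j * (E zero j * F j i)))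
    ≡⟨ sum-+ (λ j → s j * (D zero j * detℤ (minorE j))) (λ j → sumℤ (λ i → s j * (E zero j * F j i))) ⟩
  detℤ (setRow E zero (D zero)) + sumℤ (λ j → sumℤ (λ i → s j * (E zero j * F j i)))
    ≡⟨ +-congˡ (detℤ (setRow E zero (D zero))) (trans (sum-swap (λ j i → s j * (E zero j * F j i)))
         (sum-cong λ i → sum-cong λ j → cong (λ y → s j * (E zero j * y))
           (sym (detℤ-cong (setRow-minor (E ∘ suc) i (D (suc i)) (punchIn j)))))) ⟩
  sumℤ (λ i → detℤ (setRow E i (D i))) ∎
  where
  open ≡-Reasoning
  s : Fin (suc n) → ℤ
  s j = sgn (toℕ j)
  E D : Mat (suc n)
  E r c = eval (M r c) x
  D r c = eval (deriv (M r c)) x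
  minor : Fin (suc n) → Fin n → Fin n → Poly
  minor j r c = M (suc r) (punchIn j c)
  minorE : Fin (suc n) → Mat n
  minorE j r c = E (suc r) (punchIn j c)
  F : Fin (suc n) → Fin n → ℤ
  F j i = detℤ (setRow (minorE j) i (λ c → D (suc i) (punchIn j c)))
  distribute : ∀ s a b c d → s * (a * b + c * d) ≡ s * (a * b) + s * (c * d)
  distribute = solve-∀
  expandTerm : ∀ j → eval (deriv (scale (s j) (M zero j ⊗ det (minor j)))) x ≡
    s j * (D zero j * detℤ (minorE j)) + sumℤ (λ i → s j * (E zero j * F j i))
  expandTerm j = begin
    eval (deriv (scale (s j) (M zero j ⊗ det (minor j)))) x
      ≡⟨ eval-deriv-scale (s j) (M zero j ⊗ det (minor j)) x ⟩
    s j * eval (deriv (M zero j ⊗ det (minor j))) x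
      ≡⟨ cong (s j *_) (eval-deriv-⊗ (M zero j) (det (minor j)) x) ⟩
    s j * (D zero j * eval (det (minor j)) x + E zero j * eval (deriv (det (minor j))) x)
      ≡⟨ cong₂ (λ y z → s j * (D zero j * y + E zero j * z)) (eval-det (minor j) x) (eval-deriv-det (minor j) x) ⟩
    s j * (D zero j * detℤ (minorE j) + E zero j * sumℤ (F j))
      ≡⟨ distribute (s j) (D zero j) (detℤ (minorE j)) (E zero j) (sumℤ (F j)) ⟩
    s j * (D zero j * detℤ (minorE j)) + s j * (E zero j * sumℤ (F j))
      ≡⟨ +-congˡ (s j * (D zero j * detℤ (minorE j)))
           (trans (cong (s j *_) (sum-*ˡ (E zero j) (F j))) (sum-*ˡ (s j) (λ i → E zero j * F j i))) ⟩
    s j * (D zero j * detℤ (minorE j)) + sumℤ (λ i → s j * (E zero j * F j i)) ∎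

coeff-⊕ : ∀ p q k → coeff (p ⊕ q) k ≡ coeff p k + coeff q k
coeff-⊕ []      q       k       = sym (ℤ.+-identityˡ (coeff q k))
coeff-⊕ (a ∷ p) []      k       = sym (ℤ.+-identityʳ (coeff (a ∷ p) k))
coeff-⊕ (a ∷ p) (b ∷ q) zero    = refl
coeff-⊕ (a ∷ p) (b ∷ q) (suc k) = coeff-⊕ p q k

coeff-scale : ∀ a p k → coeff (scale a p) k ≡ a * coeff p k
coeff-scale a []      k       = sym (ℤ.*-zeroʳ a)
coeff-scale a (b ∷ p) zero    = refl
coeff-scale a (b ∷ p) (suc k) = coeff-scale a p k

coeff-sumPoly : ∀ {n} (f : Fin n → Poly) k → coeff (sumPoly f) k ≡ sumℤ (λ i → coeff (f i) k)
coeff-sumPoly {zero}  f k = refl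
coeff-sumPoly {suc n} f k =
  trans (coeff-⊕ (f zero) (sumPoly (f ∘ suc)) k) (+-congˡ (coeff (f zero) k) (coeff-sumPoly (f ∘ suc) k))

coeff-deriv : ∀ p k → coeff (deriv p) k ≡ + suc k * coeff p (suc k)
coeff-deriv []      k       = sym (ℤ.*-zeroʳ (+ suc k))
coeff-deriv (a ∷ p) zero    = trans (coeff-⊕ p (+ 0 ∷ deriv p) zero) (lemma (coeff p zero))
  where
  lemma : ∀ x → x + + 0 ≡ + 1 * x
  lemma = solve-∀
coeff-deriv (a ∷ p) (suc k) = trans (coeff-⊕ p (+ 0 ∷ deriv p) (suc k))
  (trans (+-congˡ (coeff p (suc k)) (coeff-deriv p k)) (lemma (+ suc k) (coeff p (suc k))))
  where
  lemma : ∀ j x → x + j * x ≡ (+ 1 + j) * x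
  lemma = solve-∀

m≡[1+m]*k⇒m≡0 : ∀ m k → m ≡ suc m ℕ.* k → m ≡ 0
m≡[1+m]*k⇒m≡0 m zero    eq = trans eq (ℕ.*-zeroʳ (suc m))
m≡[1+m]*k⇒m≡0 m (suc k) eq =
  contradiction (subst (suc m ℕ.≤_) (sym eq) (ℕ.m≤m*n (suc m) (suc k))) (ℕ.<-irrefl refl)

-- The constant term a is divisible by 1 + ∣ a ∣, hence 0.
eval≡0⇒coeff≡0 : ∀ p → (∀ m → eval p (+ suc m) ≡ + 0) → ∀ k → coeff p k ≡ + 0
eval≡0⇒coeff≡0 []      z k = refl
eval≡0⇒coeff≡0 (a ∷ p) z = λ { zero → a≡0 ; (suc k) → eval≡0⇒coeff≡0 p p-zero k }
  where
  y : ℤ → ℤ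
  y = eval p
  x+y≡0⇒x≡-y : ∀ x y → x + y ≡ + 0 → x ≡ - y
  x+y≡0⇒x≡-y x y eq = trans (lemma x y) (trans (cong (_- y) eq) (ℤ.+-identityˡ (- y)))
    where
    lemma : ∀ x y → x ≡ x + y - y
    lemma = solve-∀
  ∣a∣≡ : ∣ a ∣ ≡ suc ∣ a ∣ ℕ.* ∣ y (+ suc ∣ a ∣) ∣
  ∣a∣≡ = trans (cong ∣_∣ (x+y≡0⇒x≡-y a (+ suc ∣ a ∣ * y (+ suc ∣ a ∣)) (z ∣ a ∣)))
        (trans (ℤ.∣-i∣≡∣i∣ (+ suc ∣ a ∣ * y (+ suc ∣ a ∣))) (ℤ.abs-* (+ suc ∣ a ∣) (y (+ suc ∣ a ∣))))
  a≡0 : a ≡ + 0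
  a≡0 = ℤ.∣i∣≡0⇒i≡0 (m≡[1+m]*k⇒m≡0 ∣ a ∣ _ ∣a∣≡)
  p-zero : ∀ m → eval p (+ suc m) ≡ + 0
  p-zero m = ℤ.*-cancelˡ-≡ (+ suc m) (y (+ suc m)) (+ 0)
    (trans (sym (ℤ.+-identityˡ (+ suc m * y (+ suc m))))
    (trans (cong (λ a → a + + suc m * y (+ suc m)) (sym a≡0))
    (trans (z m) (sym (ℤ.*-zeroʳ (+ suc m))))))

eval≡⇒coeff≡ : ∀ p q → (∀ x → eval p x ≡ eval q x) → ∀ k → coeff p k ≡ coeff q k
eval≡⇒coeff≡ p q eq k = x-y≡0 (coeff p k) (coeff q k)
  (trans (sym (trans (coeff-⊕ p (scale (- + 1) q) k) (+-congˡ (coeff p k) (coeff-scale (- + 1) q k))))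
         (eval≡0⇒coeff≡0 (p ⊕ scale (- + 1) q) (λ m → difference (+ suc m)) k))
  where
  difference : ∀ x → eval (p ⊕ scale (- + 1) q) x ≡ + 0
  difference x = trans (eval-⊕ p (scale (- + 1) q) x)
    (trans (cong₂ _+_ (eq x) (eval-scale (- + 1) q x)) (lemma (eval q x)))
    where
    lemma : ∀ y → y + - + 1 * y ≡ + 0
    lemma = solve-∀
  x-y≡0 : ∀ x y → x + - + 1 * y ≡ + 0 → x ≡ y
  x-y≡0 x y e = trans (lemma x y) (trans (cong (_+ y) e) (ℤ.+-identityˡ y))
    where
    lemma : ∀ x y → x ≡ x + - + 1 * y + y
    lemma = solve-∀

coeff-length : ∀ p k → length p ℕ.≤ k → coeff p k ≡ + 0
coeff-length []      k       le = refl
coeff-length (a ∷ p) (suc k) le = coeff-length p k (ℕ.s≤s⁻¹ le)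

length-⊕ : ∀ p q {d} → length p ℕ.≤ d → length q ℕ.≤ d → length (p ⊕ q) ℕ.≤ d
length-⊕ []      q       _         q≤ = q≤
length-⊕ (a ∷ p) []      p≤        _  = p≤
length-⊕ (a ∷ p) (b ∷ q) {suc d} p≤ q≤ = ℕ.s≤s (length-⊕ p q (ℕ.s≤s⁻¹ p≤) (ℕ.s≤s⁻¹ q≤))

length-scale : ∀ a p {d} → length p ℕ.≤ d → length (scale a p) ℕ.≤ d
length-scale a p = subst (ℕ._≤ _) (sym (length-map (a *_) p))

length-⊗ : ∀ p q {d e} → length p ℕ.≤ suc d → length q ℕ.≤ suc e → length (p ⊗ q) ℕ.≤ suc (d ℕ.+ e)
length-⊗ []           q p≤ q≤ = ℕ.z≤n
length-⊗ (a ∷ [])     q {d} {e} p≤ q≤ =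
  length-⊕ (scale a q) _ (length-scale a q (ℕ.≤-trans q≤ (ℕ.s≤s (ℕ.m≤n+m e d)))) (ℕ.s≤s ℕ.z≤n)
length-⊗ (a ∷ b ∷ p)  q {zero}      p≤ q≤ = contradiction (ℕ.s≤s⁻¹ p≤) λ ()
length-⊗ (a ∷ b ∷ p)  q {suc d} {e} p≤ q≤ =
  length-⊕ (scale a q) _ (length-scale a q (ℕ.≤-trans q≤ (ℕ.s≤s (ℕ.m≤n+m e (suc d)))))
    (ℕ.s≤s (length-⊗ (b ∷ p) q (ℕ.s≤s⁻¹ p≤) q≤))

length-sumPoly : ∀ {n} (f : Fin n → Poly) {d} → (∀ i → length (f i) ℕ.≤ d) → length (sumPoly f) ℕ.≤ d
length-sumPoly {zero}  f le = ℕ.z≤n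
length-sumPoly {suc n} f le = length-⊕ (f zero) _ (le zero) (length-sumPoly (f ∘ suc) (le ∘ suc))

sumℕ : ∀ {n} → (Fin n → ℕ) → ℕ
sumℕ {zero}  d = 0
sumℕ {suc n} d = d zero ℕ.+ sumℕ (d ∘ suc)

sumℕ-ones : ∀ m → sumℕ {m} (const 1) ≡ m
sumℕ-ones zero    = refl
sumℕ-ones (suc m) = cong suc (sumℕ-ones m)

length-det : ∀ {n} (M : Fin n → Fin n → Poly) (d : Fin n → ℕ) →
  (∀ i j → length (M i j) ℕ.≤ suc (d i)) → length (det M) ℕ.≤ suc (sumℕ d)
length-det {zero}  M d le = ℕ.s≤s ℕ.z≤n
length-det {suc n} M d le = length-sumPoly (λ j → scale (sgn (toℕ j)) (M zero j ⊗ det (minor j))) λ j →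
  length-scale (sgn (toℕ j)) (M zero j ⊗ det (minor j)) (length-⊗ (M zero j) (det (minor j)) (le zero j)
    (length-det (minor j) (d ∘ suc) λ r c → le (suc r) (punchIn j c)))
  where
  minor : Fin (suc n) → Fin n → Fin n → Poly
  minor j r c = M (suc r) (punchIn j c)

det-cong : ∀ {n} {M N : Fin n → Fin n → Poly} → (∀ i j → M i j ≡ N i j) → det M ≡ det N
det-cong {zero}  p = refl
det-cong {suc n} {M} {N} p = sumPoly-cong λ j → cong (scale (sgn (toℕ j)))
  (cong₂ _⊗_ (p zero j) (det-cong λ r c → p (suc r) (punchIn j c)))
  where
  sumPoly-cong : ∀ {m} {f g : Fin m → Poly} → (∀ i → f i ≡ g i) → sumPoly f ≡ sumPoly g
  sumPoly-cong {zero}  eq = refl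
  sumPoly-cong {suc m} eq = cong₂ _⊕_ (eq zero) (sumPoly-cong (eq ∘ suc))

-- Newton's identities for characteristic polynomials

charMatrix : ∀ {n} → Mat n → Fin n → Fin n → Poly
charMatrix M i j = (if i == j then xP else []) ⊕ constP (- M i j)

module CharPoly {n} (M : Mat n) where

  χ : ℕ → ℤ
  χ = coeff (det (charMatrix M))

  -- Entry (j , i) of the adjugate of xI − M, as the determinant of xI − M
  -- with row i replaced by the j-th unit vector.
  adjugate : Fin n → Fin n → Poly
  adjugate j i = det (setRow (charMatrix M) i (λ c → constP (idMat j c)))

  adjCoeff : ℕ → Mat n
  adjCoeff k j i = coeff (adjugate j i) k

  eval-constP : ∀ a x → eval (constP a) x ≡ a
  eval-constP a x = trans (+-congˡ a (ℤ.*-zeroʳ x)) (ℤ.+-identityʳ a)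

  X : ℤ → Mat n
  X x i j = eval (charMatrix M i j) x

  X-entry : ∀ x i j → X x i j ≡ idMat i j * x - M i j
  X-entry x i j with i == j
  ... | true  = lemma x (M i j)
    where
    lemma : ∀ x m → (+ 0 + - m) + x * (+ 1 + x * + 0) ≡ + 1 * x - m
    lemma = solve-∀
  ... | false = lemma x (M i j)
    where
    lemma : ∀ x m → - m + x * + 0 ≡ + 0 * x - m
    lemma = solve-∀

  eval-deriv-charMatrix : ∀ x i j → eval (deriv (charMatrix M i j)) x ≡ idMat i j
  eval-deriv-charMatrix x i j with i == j
  ... | true  = lemma x
    where
    lemma : ∀ x → (+ 1 + + 0) + x * (+ 0 + x * + 0) ≡ + 1
    lemma = solve-∀
  ... | false = lemma x
    where
    lemma : ∀ x → + 0 + x * + 0 ≡ + 0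
    lemma = solve-∀

  eval-adjugate : ∀ x j i → eval (adjugate j i) x ≡ detℤ (setRow (X x) i (idMat j))
  eval-adjugate x j i = trans (eval-det (setRow (charMatrix M) i (λ c → constP (idMat j c))) x)
    (detℤ-cong λ r c → trans
      (cong (λ h → h c) (setRow-map (λ row c → eval (row c) x) (charMatrix M) i (λ c → constP (idMat j c)) r))
      (setRow-cong i {w = idMat j} (λ _ _ → refl) (λ c → eval-constP (idMat j c) x) r c))

  X-adjugate : ∀ x k i → sumℤ (λ j → X x k j * eval (adjugate j i) x) ≡ idMat k i * detℤ (X x)
  X-adjugate x k i = begin
    sumℤ (λ j → X x k j * eval (adjugate j i) x)
      ≡⟨ sum-cong (λ j → cong (X x k j *_) (eval-adjugate x j i)) ⟩
    sumℤ (λ j → X x k j * detℤ (setRow (X x) i (idMat j)))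
      ≡⟨ detℤ-setRow-sum (X x) i (X x k) idMat ⟨
    detℤ (setRow (X x) i (λ c → sumℤ (λ j → X x k j * idMat j c)))
      ≡⟨ detℤ-cong (setRow-cong i {w = X x k} (λ _ _ → refl) (λ c → sum-idMatʳ c (X x k))) ⟩
    detℤ (setRow (X x) i (X x k))
      ≡⟨ substituted ⟩
    idMat k i * detℤ (X x) ∎
    where
    open ≡-Reasoning
    substituted : detℤ (setRow (X x) i (X x k)) ≡ idMat k i * detℤ (X x)
    substituted with k Fin.≟ i
    ... | yes refl = trans (detℤ-cong λ r c → cong (λ h → h c) (setRow-self (X x) k r)) (sym (ℤ.*-identityˡ _))
    ... | no k≢i   = trans (detℤ-alternating (setRow (X x) i (X x k)) i k (k≢i ∘ sym)
        λ c → cong (λ h → h c) (trans (setRow-updates (X x) i (X x k)) (sym (setRow-minimal (X x) i (X x k) k k≢i))))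
      (sym (ℤ.*-zeroˡ (detℤ (X x))))

  private
    product : Fin n → Fin n → Poly
    product k i = (+ 0 ∷ adjugate k i) ⊕ sumPoly (λ j → scale (- M k j) (adjugate j i))

    eval-product : ∀ k i x → eval (product k i) x ≡ eval (scale (idMat k i) (det (charMatrix M))) x
    eval-product k i x = begin
      eval (product k i) x
        ≡⟨ eval-⊕ (+ 0 ∷ adjugate k i) (sumPoly λ j → scale (- M k j) (adjugate j i)) x ⟩
      (+ 0 + x * a k) + eval (sumPoly (λ j → scale (- M k j) (adjugate j i))) x
        ≡⟨ cong₂ _+_ (trans (ℤ.+-identityˡ (x * a k)) (cong (x *_) (sym (sum-idMatˡ k a))))
             (trans (eval-sumPoly (λ j → scale (- M k j) (adjugate j i)) x)
                    (sum-cong λ j → eval-scale (- M k j) (adjugate j i) x)) ⟩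
      x * sumℤ (λ j → idMat k j * a j) + sumℤ (λ j → - M k j * a j)
        ≡⟨ cong (_+ sumℤ (λ j → - M k j * a j)) (sum-*ˡ x (λ j → idMat k j * a j)) ⟩
      sumℤ (λ j → x * (idMat k j * a j)) + sumℤ (λ j → - M k j * a j)
        ≡⟨ sum-+ (λ j → x * (idMat k j * a j)) (λ j → - M k j * a j) ⟨
      sumℤ (λ j → x * (idMat k j * a j) + - M k j * a j)
        ≡⟨ sum-cong (λ j → trans (lemma x (idMat k j) (M k j) (a j)) (cong (_* a j) (sym (X-entry x k j)))) ⟩
      sumℤ (λ j → X x k j * a j)
        ≡⟨ X-adjugate x k i ⟩
      idMat k i * detℤ (X x)
        ≡⟨ cong (idMat k i *_) (eval-det (charMatrix M) x) ⟨
      idMat k i * eval (det (charMatrix M)) x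
        ≡⟨ eval-scale (idMat k i) (det (charMatrix M)) x ⟨
      eval (scale (idMat k i) (det (charMatrix M))) x ∎
      where
      open ≡-Reasoning
      a : Fin n → ℤ
      a j = eval (adjugate j i) x
      lemma : ∀ x d m a → x * (d * a) + - m * a ≡ (d * x - m) * a
      lemma = solve-∀

    coeff-product : ∀ m k i →
      coeff (+ 0 ∷ adjugate k i) m - (M ⊙ adjCoeff m) k i ≡ idMat k i * χ m
    coeff-product m k i = begin
      coeff (+ 0 ∷ adjugate k i) m - (M ⊙ adjCoeff m) k i
        ≡⟨ +-congˡ (coeff (+ 0 ∷ adjugate k i) m) (trans (sym (sum-neg λ j → M k j * adjCoeff m j i))
             (sum-cong λ j → trans (ℤ.neg-distribˡ-* (M k j) (adjCoeff m j i))
                                   (sym (coeff-scale (- M k j) (adjugate j i) m)))) ⟩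
      coeff (+ 0 ∷ adjugate k i) m + sumℤ (λ j → coeff (scale (- M k j) (adjugate j i)) m)
        ≡⟨ +-congˡ (coeff (+ 0 ∷ adjugate k i) m) (coeff-sumPoly (λ j → scale (- M k j) (adjugate j i)) m) ⟨
      coeff (+ 0 ∷ adjugate k i) m + coeff (sumPoly (λ j → scale (- M k j) (adjugate j i))) m
        ≡⟨ coeff-⊕ (+ 0 ∷ adjugate k i) (sumPoly (λ j → scale (- M k j) (adjugate j i))) m ⟨
      coeff (product k i) m
        ≡⟨ eval≡⇒coeff≡ (product k i) (scale (idMat k i) (det (charMatrix M))) (eval-product k i) m ⟩
      coeff (scale (idMat k i) (det (charMatrix M))) m
        ≡⟨ coeff-scale (idMat k i) (det (charMatrix M)) m ⟩
      idMat k i * χ m ∎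
      where open ≡-Reasoning

  adjCoeff-zero : M ⊙ adjCoeff 0 ≋ λ k i → - (χ 0) * idMat k i
  adjCoeff-zero k i = lemma ((M ⊙ adjCoeff 0) k i) (idMat k i) (χ 0) (coeff-product 0 k i)
    where
    negate : ∀ m → m ≡ - (+ 0 - m)
    negate = solve-∀
    commute : ∀ d c → - (d * c) ≡ - c * d
    commute = solve-∀
    lemma : ∀ m d c → + 0 - m ≡ d * c → m ≡ - c * d
    lemma m d c eq = trans (negate m) (trans (cong -_ eq) (commute d c))

  adjCoeff-suc : ∀ m → adjCoeff m ≋ λ k i → (M ⊙ adjCoeff (suc m)) k i + χ (suc m) * idMat k i
  adjCoeff-suc m k i = lemma (adjCoeff m k i) ((M ⊙ adjCoeff (suc m)) k i) (idMat k i) (χ (suc m))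
    (coeff-product (suc m) k i)
    where
    add-back : ∀ a m → a ≡ m + (a - m)
    add-back = solve-∀
    lemma : ∀ a m d c → a - m ≡ d * c → a ≡ m + c * d
    lemma a m d c eq = trans (add-back a m) (+-congˡ m (trans eq (ℤ.*-comm d c)))

  Tr-adjCoeff : ∀ m → Tr (adjCoeff m) ≡ + suc m * χ (suc m)
  Tr-adjCoeff m = trans (sym (coeff-sumPoly (λ i → adjugate i i) m))
    (trans (eval≡⇒coeff≡ (sumPoly λ i → adjugate i i) (deriv (det (charMatrix M))) same m)
           (coeff-deriv (det (charMatrix M)) m))
    where
    same : ∀ x → eval (sumPoly (λ i → adjugate i i)) x ≡ eval (deriv (det (charMatrix M))) x
    same x = trans (eval-sumPoly (λ i → adjugate i i) x)
      (trans (sum-cong λ i → trans (eval-adjugate x i i)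
               (detℤ-cong (setRow-cong i (λ _ _ → refl) λ c → sym (eval-deriv-charMatrix x i c))))
             (sym (eval-deriv-det (charMatrix M) x)))

  τ : ℕ → ℕ → ℤ
  τ j k = Tr (matPow M j ⊙ adjCoeff k)

  τ-step : ∀ j m → τ j m ≡ τ (suc j) (suc m) + χ (suc m) * Tr (matPow M j)
  τ-step j m = trans (sum-cong λ i → entry i i)
    (trans (sum-+ (λ i → (matPow M (suc j) ⊙ adjCoeff (suc m)) i i) (λ i → χ (suc m) * P i i))
           (+-congˡ (τ (suc j) (suc m)) (sym (sum-*ˡ (χ (suc m)) (λ i → P i i)))))
    where
    open ≡-Reasoning
    P : Mat n
    P = matPow M j
    distribute : ∀ p a c d → p * (a + c * d) ≡ p * a + c * (p * d)
    distribute = solve-∀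
    entry : P ⊙ adjCoeff m ≋ λ a b → (matPow M (suc j) ⊙ adjCoeff (suc m)) a b + χ (suc m) * P a b
    entry a b = begin
      (P ⊙ adjCoeff m) a b
        ≡⟨ sum-cong (λ k → trans (cong (P a k *_) (adjCoeff-suc m k b))
             (distribute (P a k) ((M ⊙ adjCoeff (suc m)) k b) (χ (suc m)) (idMat k b))) ⟩
      sumℤ (λ k → P a k * (M ⊙ adjCoeff (suc m)) k b + χ (suc m) * (P a k * idMat k b))
        ≡⟨ sum-+ (λ k → P a k * (M ⊙ adjCoeff (suc m)) k b) (λ k → χ (suc m) * (P a k * idMat k b)) ⟩
      (P ⊙ (M ⊙ adjCoeff (suc m))) a b + sumℤ (λ k → χ (suc m) * (P a k * idMat k b))
        ≡⟨ cong₂ _+_ (trans (sym (⊙-assoc P M (adjCoeff (suc m)) a b)) (⊙-congʳ (adjCoeff (suc m)) (matPow-sucʳ M j) a b))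
             (trans (sym (sum-*ˡ (χ (suc m)) (λ k → P a k * idMat k b))) (cong (χ (suc m) *_) (sum-idMatʳ b (P a)))) ⟩
      (matPow M (suc j) ⊙ adjCoeff (suc m)) a b + χ (suc m) * P a b ∎

  τ-one : ∀ k → τ 1 k ≡ (+ k - + n) * χ k
  τ-one zero = begin
    τ 1 0                                 ≡⟨ Tr-cong (⊙-congʳ (adjCoeff 0) (⊙-identityʳ M) ⟫ adjCoeff-zero) ⟩
    sumℤ {n} (λ i → - (χ 0) * idMat i i)  ≡⟨ sum-*ˡ {n} (- (χ 0)) (λ i → idMat i i) ⟨
    - (χ 0) * Tr (idMat {n})              ≡⟨ cong (- (χ 0) *_) (Tr-idMat {n}) ⟩
    - (χ 0) * + n                         ≡⟨ lemma (χ 0) (+ n) ⟩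
    (+ 0 - + n) * χ 0                     ∎
    where
    open ≡-Reasoning
    lemma : ∀ c n → - c * n ≡ (+ 0 - n) * c
    lemma = solve-∀
  τ-one (suc m) = lemma (τ 1 (suc m)) (χ (suc m)) (+ suc m) (+ n)
    (trans (sym (Tr-adjCoeff m)) (trans (Tr-cong (≋-sym (⊙-identityˡ (adjCoeff m)))) (trans (τ-step 0 m)
      (+-congˡ (τ 1 (suc m)) (cong (χ (suc m) *_) (Tr-idMat {n}))))))
    where
    subtract : ∀ t c n → t ≡ (t + c * n) - c * n
    subtract = solve-∀
    factor : ∀ c k n → k * c - c * n ≡ (k - n) * c
    factor = solve-∀
    lemma : ∀ t c k n → k * c ≡ t + c * n → t ≡ (k - n) * c
    lemma t c k n eq = trans (subtract t c n) (trans (cong (_- c * n) (sym eq)) (factor c k n))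

  length-charMatrix : ∀ i j → length (charMatrix M i j) ℕ.≤ 2
  length-charMatrix i j with i == j
  ... | true  = ℕ.≤-refl
  ... | false = ℕ.s≤s ℕ.z≤n

  length-adjugate : ∀ j i → length (adjugate j i) ℕ.≤ n
  length-adjugate j i = subst (length (adjugate j i) ℕ.≤_) (sum-setRow i)
    (length-det (setRow (charMatrix M) i (λ c → constP (idMat j c))) (setRow (const 1) i 0) row-length)
    where
    sum-setRow : ∀ {m} (i : Fin m) → suc (sumℕ (setRow (const 1) i 0)) ≡ m
    sum-setRow {suc m} zero    = cong suc (sumℕ-ones m)
    sum-setRow {suc m} (suc i) = cong suc (sum-setRow i)
    row-length : ∀ r c → length (setRow (charMatrix M) i (λ c → constP (idMat j c)) r c) ℕ.≤ suc (setRow (const 1) i 0 r)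
    row-length r c with r Fin.≟ i
    ... | yes refl rewrite setRow-updates (charMatrix M) r (λ c → constP (idMat j c)) = ℕ.s≤s ℕ.z≤n
    ... | no r≢i
      rewrite setRow-minimal (charMatrix M) i (λ c → constP (idMat j c)) r r≢i
            | setRow-minimal (const 1) i 0 r r≢i = length-charMatrix r c

  τ-top : ∀ j → τ j n ≡ + 0
  τ-top j = sum-zero λ i → sum-zero λ k →
    trans (cong (matPow M j i k *_) (coeff-length (adjugate k i) n (length-adjugate k i))) (ℤ.*-zeroʳ (matPow M j i k))

  newtonSum : ℕ → ℕ → ℤ
  newtonSum zero    j = + 0
  newtonSum (suc i) j = newtonSum i (suc j) + χ (n ℕ.∸ i) * Tr (matPow M j)

  τ-newtonSum : ∀ i j → i ℕ.≤ n → τ j (n ℕ.∸ i) ≡ newtonSum i j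
  τ-newtonSum zero    j le = τ-top j
  τ-newtonSum (suc i) j le = trans (τ-step j (n ℕ.∸ suc i))
    (trans (cong (λ m → τ (suc j) m + χ m * Tr (matPow M j)) (sym (ℕ.+-∸-assoc 1 le)))
           (cong (_+ χ (n ℕ.∸ i) * Tr (matPow M j)) (τ-newtonSum i (suc j) (ℕ.<⇒≤ le))))

  newton : ∀ i → i ℕ.≤ n → newtonSum i 1 ≡ - + i * χ (n ℕ.∸ i)
  newton i le = trans (sym (τ-newtonSum i 1 le)) (trans (τ-one (n ℕ.∸ i))
    (cong (_* χ (n ℕ.∸ i)) (trans (cong (_- + n) (trans (sym (ℤ.⊖-≥ le)) (sym (ℤ.m-n≡m⊖n n i))))
      (lemma (+ n) (+ i)))))
    where
    lemma : ∀ n i → (n - i) - n ≡ - i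
    lemma = solve-∀

charPoly-monic : ∀ {n} (M : Mat n) → CharPoly.χ M n ≡ + 1
charPoly-monic {zero}  M = refl
charPoly-monic {suc n} M = begin
  coeff (det X) (suc n)
    ≡⟨ coeff-sumPoly (λ j → scale (sgn (toℕ j)) (X zero j ⊗ det (minor j))) (suc n) ⟩
  coeff (scale (+ 1) (X zero zero ⊗ det (minor zero))) (suc n)
    + sumℤ (λ j → coeff (scale (sgn (toℕ (suc j))) (X zero (suc j) ⊗ det (minor (suc j)))) (suc n))
    ≡⟨ cong₂ _+_ leading (sum-zero λ j → coeff-length (scale (sgn (toℕ (suc j))) (X zero (suc j) ⊗ det (minor (suc j)))) (suc n)
         (length-scale (sgn (toℕ (suc j))) (X zero (suc j) ⊗ det (minor (suc j)))
           (length-⊗ (X zero (suc j)) (det (minor (suc j))) (ℕ.s≤s ℕ.z≤n) (length-minor (suc j))))) ⟩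
  + 1 ∎
  where
  open ≡-Reasoning
  X : Fin (suc n) → Fin (suc n) → Poly
  X = charMatrix M
  M′ : Mat n
  M′ r c = M (suc r) (suc c)
  minor : Fin (suc n) → Fin n → Fin n → Poly
  minor j r c = X (suc r) (punchIn j c)
  length-minor : ∀ j → length (det (minor j)) ℕ.≤ suc n
  length-minor j = subst (λ m → length (det (minor j)) ℕ.≤ suc m) (sumℕ-ones n)
    (length-det (minor j) (const 1) λ r c → CharPoly.length-charMatrix M (suc r) (punchIn j c))
  q : Poly
  q = det (minor zero)
  q-lead : coeff q n ≡ + 1
  q-lead = trans (cong (λ p → coeff p n) (det-cong λ r c → cong (λ b → (if b then xP else []) ⊕ constP (- M′ r c)) (==-suc r c)))
                 (charPoly-monic M′)
  coeff-0∷[] : ∀ k → coeff (+ 0 ∷ []) k ≡ + 0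
  coeff-0∷[] zero    = refl
  coeff-0∷[] (suc k) = refl
  a : ℤ
  a = + 0 + - M zero zero
  leading : coeff (scale (+ 1) (X zero zero ⊗ q)) (suc n) ≡ + 1
  leading = begin
    coeff (scale (+ 1) (X zero zero ⊗ q)) (suc n)
      ≡⟨ trans (coeff-scale (+ 1) (X zero zero ⊗ q) (suc n)) (ℤ.*-identityˡ (coeff (X zero zero ⊗ q) (suc n))) ⟩
    coeff (scale a q ⊕ (+ 0 ∷ (scale (+ 1) q ⊕ (+ 0 ∷ [])))) (suc n)
      ≡⟨ coeff-⊕ (scale a q) (+ 0 ∷ (scale (+ 1) q ⊕ (+ 0 ∷ []))) (suc n) ⟩
    coeff (scale a q) (suc n) + coeff (scale (+ 1) q ⊕ (+ 0 ∷ [])) n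
      ≡⟨ cong₂ _+_ (coeff-length (scale a q) (suc n) (length-scale a q (length-minor zero)))
                   (coeff-⊕ (scale (+ 1) q) (+ 0 ∷ []) n) ⟩
    + 0 + (coeff (scale (+ 1) q) n + coeff (+ 0 ∷ []) n)
      ≡⟨ cong₂ (λ x y → + 0 + (x + y)) (trans (coeff-scale (+ 1) q n) (cong (λ x → + 1 * x) q-lead)) (coeff-0∷[] n) ⟩
    + 1 ∎

sumList : ∀ {A : Set} → (A → ℤ) → List A → ℤ
sumList f []       = + 0
sumList f (x ∷ xs) = f x + sumList f xs

sum-lookup : ∀ {A : Set} (f : A → ℤ) xs → sumℤ (λ i → f (lookup xs i)) ≡ sumList f xs
sum-lookup f []       = refl
sum-lookup f (x ∷ xs) = +-congˡ (f x) (sum-lookup f xs)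

sumList-++ : ∀ {A : Set} (f : A → ℤ) xs ys → sumList f (xs ++ ys) ≡ sumList f xs + sumList f ys
sumList-++ f []       ys = sym (ℤ.+-identityˡ (sumList f ys))
sumList-++ f (x ∷ xs) ys = trans (+-congˡ (f x) (sumList-++ f xs ys)) (sym (ℤ.+-assoc (f x) (sumList f xs) (sumList f ys)))

sumList-map : ∀ {A B : Set} (f : B → ℤ) (g : A → B) xs → sumList f (map g xs) ≡ sumList (f ∘ g) xs
sumList-map f g []       = refl
sumList-map f g (x ∷ xs) = +-congˡ (f (g x)) (sumList-map f g xs)

sumList-concatMap : ∀ {A B : Set} (f : B → ℤ) (g : A → List B) xs →
  sumList f (concatMap g xs) ≡ sumList (λ x → sumList f (g x)) xs
sumList-concatMap f g []       = refl
sumList-concatMap f g (x ∷ xs) =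
  trans (sumList-++ f (g x) (concatMap g xs)) (+-congˡ (sumList f (g x)) (sumList-concatMap f g xs))

sumList-tabulate : ∀ {A : Set} {n} (f : A → ℤ) (g : Fin n → A) → sumList f (tabulate g) ≡ sumℤ (f ∘ g)
sumList-tabulate {n = zero}  f g = refl
sumList-tabulate {n = suc n} f g = +-congˡ (f (g zero)) (sumList-tabulate f (g ∘ suc))

sumList-filterᵇ : ∀ {A : Set} (f : A → ℤ) (p : A → Bool) xs →
  sumList f (filterᵇ p xs) ≡ sumList (λ x → b2ℤ (p x) * f x) xs
sumList-filterᵇ f p []       = refl
sumList-filterᵇ f p (x ∷ xs) with p x
... | true  = cong₂ _+_ (sym (ℤ.*-identityˡ (f x))) (sumList-filterᵇ f p xs)
... | false = trans (sumList-filterᵇ f p xs) (sym (ℤ.+-identityˡ (sumList (λ x → b2ℤ (p x) * f x) xs)))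

lookup-injective : ∀ {A : Set} {xs : List A} → Unique xs → ∀ i j → lookup xs i ≡ lookup xs j → i ≡ j
lookup-injective (x∉ ∷ u) zero    zero    eq = refl
lookup-injective (x∉ ∷ u) zero    (suc j) eq = contradiction eq (All.lookup x∉ (∈-lookup j))
lookup-injective (x∉ ∷ u) (suc i) zero    eq = contradiction (sym eq) (All.lookup x∉ (∈-lookup i))
lookup-injective (x∉ ∷ u) (suc i) (suc j) eq = cong suc (lookup-injective u i j eq)

concatMap-pairs : ∀ {A B : Set} (xs : List A) (ys : List B) →
  concatMap (λ x → map (λ y → (x , y)) ys) xs ≡ cartesianProduct xs ys
concatMap-pairs []       ys = refl
concatMap-pairs (x ∷ xs) ys = cong (map (x ,_) ys ++_) (concatMap-pairs xs ys)

<ᵇ-true : ∀ {m n} → m ℕ.< n → (m <ᵇ n) ≡ true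
<ᵇ-true lt = Equivalence.to Bool.T-≡ (ℕ.<⇒<ᵇ lt)

<ᵇ-false : ∀ {m n} → ¬ m ℕ.< n → (m <ᵇ n) ≡ false
<ᵇ-false {m} {n} nlt with m <ᵇ n in eq
... | false = refl
... | true  = contradiction (ℕ.<ᵇ⇒< m n (subst T (sym eq) _)) nlt

module Incidence {n} (G : Graph n) where

  A : Mat n
  A = adjMat G

  deg : Fin n → ℤ
  deg = degree G

  signless : Mat n
  signless i j = idMat i j * deg i + A i j

  A-irrefl : ∀ i → A i i ≡ + 0
  A-irrefl i rewrite irrefl G i = refl

  A-sym : ∀ i j → A i j ≡ A j i
  A-sym i j = cong b2ℤ (Graph.sym G i j)

  end : Fin (numEdges G) → Fin n × Fin n
  end = lookup (edgeList G)

  unique-edgeList : Unique (edgeList G)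
  unique-edgeList = Unique.filter⁺ _
    (subst Unique (sym (concatMap-pairs (allFin n) (allFin n)))
      (Unique.cartesianProduct⁺ (Unique.allFin⁺ n) (Unique.allFin⁺ n)))

  end-ordered : ∀ e → toℕ (proj₁ (end e)) ℕ.< toℕ (proj₂ (end e))
  end-ordered e = ℕ.<ᵇ⇒< _ _ (proj₁ (Equivalence.to Bool.T-∧
    (All.lookup (All.all-filter _ (concatMap (λ i → map (λ j → (i , j)) (allFin n)) (allFin n))) (∈-lookup e))))

  incidence : Matrix n (numEdges G)
  incidence i e = idMat i (proj₁ (end e)) + idMat i (proj₂ (end e))

  incidenceᵀ : Matrix (numEdges G) n
  incidenceᵀ e i = incidence i e

  oriented : Mat n
  oriented i j = b2ℤ ((toℕ i <ᵇ toℕ j) ∧ adj G i j)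

  oriented-sum : ∀ i j → oriented i j + oriented j i ≡ A i j
  oriented-sum i j with ℕ.<-cmp (toℕ i) (toℕ j)
  ... | tri< i<j _ ¬j<i rewrite <ᵇ-true i<j | <ᵇ-false ¬j<i = ℤ.+-identityʳ (A i j)
  ... | tri> ¬i<j _ j<i rewrite <ᵇ-true j<i | <ᵇ-false ¬i<j = trans (ℤ.+-identityˡ (A j i)) (A-sym j i)
  ... | tri≈ ¬i<j i≡j ¬j<i rewrite <ᵇ-false ¬j<i | <ᵇ-false ¬i<j =
    sym (trans (cong (A i) (sym (Fin.toℕ-injective i≡j))) (A-irrefl i))

  sum-edges : ∀ (f : Fin n × Fin n → ℤ) →
    sumℤ (λ e → f (end e)) ≡ sumℤ (λ a → sumℤ (λ b → oriented a b * f (a , b)))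
  sum-edges f = begin
    sumℤ (λ e → f (end e))
      ≡⟨ sum-lookup f (edgeList G) ⟩
    sumList f (edgeList G)
      ≡⟨ sumList-filterᵇ f _ (concatMap (λ i → map (λ j → (i , j)) (allFin n)) (allFin n)) ⟩
    sumList g (concatMap (λ i → map (λ j → (i , j)) (allFin n)) (allFin n))
      ≡⟨ sumList-concatMap g (λ i → map (λ j → (i , j)) (allFin n)) (allFin n) ⟩
    sumList (λ a → sumList g (map (λ b → (a , b)) (allFin n))) (allFin n)
      ≡⟨ sumList-tabulate (λ a → sumList g (map (λ b → (a , b)) (allFin n))) (λ i → i) ⟩
    sumℤ (λ a → sumList g (map (λ b → (a , b)) (allFin n)))
      ≡⟨ sum-cong (λ a → trans (sumList-map g (λ b → (a , b)) (allFin n)) (sumList-tabulate (λ b → g (a , b)) (λ i → i))) ⟩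
    sumℤ (λ a → sumℤ (λ b → oriented a b * f (a , b))) ∎
    where
    open ≡-Reasoning
    g : Fin n × Fin n → ℤ
    g (a , b) = oriented a b * f (a , b)

  incidence-signless : incidence ⊙ incidenceᵀ ≋ signless
  incidence-signless i j = begin
    sumℤ (λ e → incidence i e * incidence j e)
      ≡⟨ sum-edges (λ (a , b) → (δ i a + δ i b) * (δ j a + δ j b)) ⟩
    sumℤ (λ a → sumℤ (λ b → w a b * ((δ i a + δ i b) * (δ j a + δ j b))))
      ≡⟨ sum-cong (λ a → trans (sum-cong λ b → expand (w a b) (δ i a) (δ i b) (δ j a) (δ j b))
           (trans (sum-+ (λ b → δ i b * (δ j b * w a b) + δ i b * (δ j a * w a b))
                         (λ b → δ i a * (δ j b * w a b) + δ i a * (δ j a * w a b)))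
             (cong₂ _+_ (trans (sum-+ (λ b → δ i b * (δ j b * w a b)) (λ b → δ i b * (δ j a * w a b)))
                          (cong₂ _+_ (sum-idMatˡ i λ b → δ j b * w a b) (sum-idMatˡ i λ b → δ j a * w a b)))
                        (trans (sum-+ (λ b → δ i a * (δ j b * w a b)) (λ b → δ i a * (δ j a * w a b)))
                          (cong₂ _+_ (sym (sum-*ˡ (δ i a) λ b → δ j b * w a b)) (sym (sum-*ˡ (δ i a) λ b → δ j a * w a b))))))) ⟩
    sumℤ (λ a → (δ j i * w a i + δ j a * w a i) + (δ i a * sumℤ (λ b → δ j b * w a b) + δ i a * sumℤ (λ b → δ j a * w a b)))
      ≡⟨ trans (sum-+ (λ a → δ j i * w a i + δ j a * w a i)
                      (λ a → δ i a * sumℤ (λ b → δ j b * w a b) + δ i a * sumℤ (λ b → δ j a * w a b)))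
           (cong₂ _+_ (trans (sum-+ (λ a → δ j i * w a i) (λ a → δ j a * w a i))
                        (cong₂ _+_ (sym (sum-*ˡ (δ j i) λ a → w a i)) (sum-idMatˡ j λ a → w a i)))
                      (trans (sum-+ (λ a → δ i a * sumℤ (λ b → δ j b * w a b)) (λ a → δ i a * sumℤ (λ b → δ j a * w a b)))
                        (cong₂ _+_ (trans (sum-idMatˡ i λ a → sumℤ (λ b → δ j b * w a b)) (sum-idMatˡ j (w i)))
                                   (trans (sum-idMatˡ i λ a → sumℤ (λ b → δ j a * w a b)) (sym (sum-*ˡ (δ j i) (w i))))))) ⟩
    (δ j i * sumℤ (λ a → w a i) + w j i) + (w i j + δ j i * sumℤ (w i))
      ≡⟨ collect (δ j i) (sumℤ (λ a → w a i)) (w j i) (w i j) (sumℤ (w i)) ⟩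
    δ j i * (sumℤ (w i) + sumℤ (λ a → w a i)) + (w i j + w j i)
      ≡⟨ cong₂ _+_ (cong₂ _*_ (idMat-sym j i) (trans (sym (sum-+ (w i) λ a → w a i)) (sum-cong (oriented-sum i))))
                   (oriented-sum i j) ⟩
    signless i j ∎
    where
    open ≡-Reasoning
    w : Mat n
    w = oriented
    δ : Mat n
    δ = idMat
    expand : ∀ w p q r s → w * ((p + q) * (r + s)) ≡
      (q * (s * w) + q * (r * w)) + (p * (s * w) + p * (r * w))
    expand = solve-∀
    collect : ∀ d x y z t → (d * x + y) + (z + d * t) ≡ d * (t + x) + (z + y)
    collect = solve-∀

  shared : (e f : Fin n × Fin n) → ℤ
  shared (a , b) (c , d) = (idMat a c + idMat a d) + (idMat b c + idMat b d)

  shared-self : ∀ a b → a ≢ b → shared (a , b) (a , b) ≡ + 2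
  shared-self a b a≢b rewrite ==-refl a | ==-refl b | ==-≢ a≢b | ==-≢ (a≢b ∘ sym) = refl

  -- Two distinct edges have at most one common end.
  shared-distinct : ∀ a b c d → toℕ a ℕ.< toℕ b → toℕ c ℕ.< toℕ d → (a , b) ≢ (c , d) →
    shared (a , b) (c , d) ≡ b2ℤ (shareEnd (a , b) (c , d))
  shared-distinct a b c d a<b c<d ne with a Fin.≟ c | a Fin.≟ d | b Fin.≟ c | b Fin.≟ d
  ... | yes refl | yes refl | _        | _        = contradiction c<d (ℕ.<-irrefl refl)
  ... | yes refl | no _     | yes refl | _        = contradiction a<b (ℕ.<-irrefl refl)
  ... | yes refl | no _     | no _     | yes refl = contradiction refl ne
  ... | yes refl | no _     | no _     | no _     = refl
  ... | no _     | yes refl | yes refl | _        = contradiction c<d (ℕ.<-asym a<b)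
  ... | no _     | yes refl | no _     | yes refl = contradiction a<b (ℕ.<-irrefl refl)
  ... | no _     | yes refl | no _     | no _     = refl
  ... | no _     | no _     | yes refl | yes refl = contradiction c<d (ℕ.<-irrefl refl)
  ... | no _     | no _     | yes refl | no _     = refl
  ... | no _     | no _     | no _     | yes refl = refl
  ... | no _     | no _     | no _     | no _     = refl

  lineShift : Mat (numEdges G)
  lineShift e f = + 2 * idMat e f + lineAdjMat G e f

  shared-lineShift : ∀ e f → shared (end e) (end f) ≡ lineShift e f
  shared-lineShift e f with e Fin.≟ f
  ... | yes refl = shared-self (proj₁ (end e)) (proj₂ (end e))
    (λ eq → ℕ.<-irrefl (cong toℕ eq) (end-ordered e))
  ... | no e≢f = trans (shared-distinct (proj₁ (end e)) (proj₂ (end e)) (proj₁ (end f)) (proj₂ (end f))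
      (end-ordered e) (end-ordered f) (e≢f ∘ lookup-injective unique-edgeList e f))
    (sym (ℤ.+-identityˡ (b2ℤ (shareEnd (end e) (end f)))))

  incidence-line : incidenceᵀ ⊙ incidence ≋ lineShift
  incidence-line e f = trans
    (trans (sum-cong λ i → expand (idMat i a₁) (idMat i b₁) (idMat i a₂) (idMat i b₂))
    (trans (sum-+ (λ i → idMat i a₂ * idMat i a₁ + idMat i b₂ * idMat i a₁) (λ i → idMat i a₂ * idMat i b₁ + idMat i b₂ * idMat i b₁))
      (cong₂ _+_ (trans (sum-+ (λ i → idMat i a₂ * idMat i a₁) (λ i → idMat i b₂ * idMat i a₁)) (cong₂ _+_ (common a₂ a₁) (common b₂ a₁)))
                 (trans (sum-+ (λ i → idMat i a₂ * idMat i b₁) (λ i → idMat i b₂ * idMat i b₁)) (cong₂ _+_ (common a₂ b₁) (common b₂ b₁))))))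
    (shared-lineShift e f)
    where
    a₁ = proj₁ (end e)
    b₁ = proj₂ (end e)
    a₂ = proj₁ (end f)
    b₂ = proj₂ (end f)
    expand : ∀ p q r s → (p + q) * (r + s) ≡ (r * p + s * p) + (r * q + s * q)
    expand = solve-∀
    common : ∀ x y → sumℤ (λ i → idMat i x * idMat i y) ≡ idMat y x
    common x y = sum-idMatʳ y (λ i → idMat i x)

  Tr-signless : ∀ k → Tr (matPow signless (suc k)) ≡ Tr (matPow lineShift (suc k))
  Tr-signless k = begin
    Tr (matPow signless (suc k))                    ≡⟨ Tr-cong (matPow-cong incidence-signless (suc k)) ⟨
    Tr (matPow (incidence ⊙ incidenceᵀ) (suc k))    ≡⟨ Tr-matPow-comm incidence incidenceᵀ k ⟩
    Tr (matPow (incidenceᵀ ⊙ incidence) (suc k))    ≡⟨ Tr-cong (matPow-cong incidence-line (suc k)) ⟩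
    Tr (matPow lineShift (suc k))                   ∎
    where open ≡-Reasoning

-- Powers of a shifted matrix

module Shift {n} (M : Mat n) where

  shift : Mat n
  shift i j = + 2 * idMat i j + M i j

  shift-⊙ : ∀ (Y : Mat n) → shift ⊙ Y ≋ λ i j → + 2 * Y i j + (M ⊙ Y) i j
  shift-⊙ Y i j = trans (sum-cong λ k → distribute (idMat i k) (M i k) (Y k j))
    (trans (sum-+ (λ k → + 2 * (idMat i k * Y k j)) (λ k → M i k * Y k j))
      (cong (_+ (M ⊙ Y) i j) (trans (sym (sum-*ˡ (+ 2) (λ k → idMat i k * Y k j)))
        (cong (λ y → + 2 * y) (sum-idMatˡ i (λ k → Y k j))))))
    where
    distribute : ∀ d m y → (+ 2 * d + m) * y ≡ + 2 * (d * y) + m * y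
    distribute = solve-∀

  mixed : ℕ → ℕ → ℤ
  mixed zero    j = Tr (matPow M j)
  mixed (suc k) j = + 2 * mixed k j + mixed k (suc j)

  Tr-mixed : ∀ k j → Tr (matPow M j ⊙ matPow shift k) ≡ mixed k j
  Tr-mixed zero    j = Tr-cong (⊙-identityʳ (matPow M j))
  Tr-mixed (suc k) j = begin
    Tr (P ⊙ (shift ⊙ Y))
      ≡⟨ Tr-cong (⊙-congˡ P (shift-⊙ Y)) ⟩
    Tr (P ⊙ (λ i j → + 2 * Y i j + (M ⊙ Y) i j))
      ≡⟨ sum-cong (λ i → trans (sum-cong λ k → distribute (P i k) (Y k i) ((M ⊙ Y) k i))
           (trans (sum-+ (λ k → + 2 * (P i k * Y k i)) (λ k → P i k * (M ⊙ Y) k i))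
             (cong₂ _+_ (sym (sum-*ˡ (+ 2) (λ k → P i k * Y k i)))
                        (trans (sym (⊙-assoc P M Y i i)) (⊙-congʳ Y (matPow-sucʳ M j) i i))))) ⟩
    sumℤ (λ i → + 2 * (P ⊙ Y) i i + (matPow M (suc j) ⊙ Y) i i)
      ≡⟨ trans (sum-+ (λ i → + 2 * (P ⊙ Y) i i) (λ i → (matPow M (suc j) ⊙ Y) i i))
           (cong (_+ Tr (matPow M (suc j) ⊙ Y)) (sym (sum-*ˡ (+ 2) (λ i → (P ⊙ Y) i i)))) ⟩
    + 2 * Tr (P ⊙ Y) + Tr (matPow M (suc j) ⊙ Y)
      ≡⟨ cong₂ (λ x y → + 2 * x + y) (Tr-mixed k j) (Tr-mixed k (suc j)) ⟩
    + 2 * mixed k j + mixed k (suc j) ∎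
    where
    open ≡-Reasoning
    P Y : Mat n
    P = matPow M j
    Y = matPow shift k
    distribute : ∀ p x y → p * (+ 2 * x + y) ≡ + 2 * (p * x) + p * y
    distribute = solve-∀

  Tr-shift : ∀ k → Tr (matPow shift k) ≡ mixed k 0
  Tr-shift k = trans (Tr-cong (≋-sym (⊙-identityˡ (matPow shift k)))) (Tr-mixed k 0)

-- Words in the degree matrix and A with an even or odd number of factors A

module Parity {n} (G : Graph n) where

  open Incidence G

  even odd : ℕ → Mat n
  even zero          = idMat
  even (suc k) i j   = deg i * even k i j + (A ⊙ odd k) i j
  odd zero     i j   = + 0
  odd (suc k)  i j   = deg i * odd k i j + (A ⊙ even k) i j

  signed : ℤ → Mat n
  signed s i j = idMat i j * deg i + s * A i j

  signed-split : ∀ s → s * s ≡ + 1 → ∀ k → matPow (signed s) k ≋ λ i j → even k i j + s * odd k i j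
  signed-split s s²≡1 zero    i j = lemma s (idMat i j)
    where
    lemma : ∀ s d → d ≡ d + s * + 0
    lemma = solve-∀
  signed-split s s²≡1 (suc k) i j = begin
    (signed s ⊙ matPow (signed s) k) i j
      ≡⟨ ⊙-congˡ (signed s) (signed-split s s²≡1 k) i j ⟩
    sumℤ (λ l → (idMat i l * deg i + s * A i l) * (even k l j + s * odd k l j))
      ≡⟨ sum-cong (λ l → trans (expand s (idMat i l) (deg i) (A i l) (even k l j) (odd k l j))
           (cong (λ x → idMat i l * Y l + (x * (A i l * odd k l j) + s * (A i l * even k l j))) s²≡1)) ⟩
    sumℤ (λ l → idMat i l * Y l + (+ 1 * (A i l * odd k l j) + s * (A i l * even k l j)))
      ≡⟨ trans (sum-+ (λ l → idMat i l * Y l) (λ l → + 1 * (A i l * odd k l j) + s * (A i l * even k l j)))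
           (cong₂ _+_ (sum-idMatˡ i Y)
             (trans (sum-+ (λ l → + 1 * (A i l * odd k l j)) (λ l → s * (A i l * even k l j)))
               (cong₂ _+_ (sym (sum-*ˡ (+ 1) (λ l → A i l * odd k l j))) (sym (sum-*ˡ s (λ l → A i l * even k l j)))))) ⟩
    deg i * (even k i j + s * odd k i j) + (+ 1 * (A ⊙ odd k) i j + s * (A ⊙ even k) i j)
      ≡⟨ collect s (deg i) (even k i j) (odd k i j) ((A ⊙ odd k) i j) ((A ⊙ even k) i j) ⟩
    even (suc k) i j + s * odd (suc k) i j ∎
    where
    open ≡-Reasoning
    Y : Fin n → ℤ
    Y l = deg i * (even k l j + s * odd k l j)
    expand : ∀ s d g a e o → (d * g + s * a) * (e + s * o) ≡ d * (g * (e + s * o)) + ((s * s) * (a * o) + s * (a * e))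
    expand = solve-∀
    collect : ∀ s g e o x y → g * (e + s * o) + (+ 1 * x + s * y) ≡ (g * e + x) + s * (g * o + y)
    collect = solve-∀

  Tr-signed : ∀ s → s * s ≡ + 1 → ∀ k → Tr (matPow (signed s) k) ≡ Tr (even k) + s * Tr (odd k)
  Tr-signed s s²≡1 k = trans (Tr-cong (signed-split s s²≡1 k))
    (trans (sum-+ (λ i → even k i i) (λ i → s * odd k i i)) (+-congˡ (Tr (even k)) (sym (sum-*ˡ s (λ i → odd k i i)))))

  signless-signed : signless ≋ signed (+ 1)
  signless-signed i j = +-congˡ (idMat i j * deg i) (sym (ℤ.*-identityˡ (A i j)))

  laplacian-signed : laplacian G ≋ signed (- + 1)
  laplacian-signed i j with i == j
  ... | true  = lemma (deg i) (A i j)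
    where
    lemma : ∀ d a → d - a ≡ + 1 * d + - + 1 * a
    lemma = solve-∀
  ... | false = lemma (deg i) (A i j)
    where
    lemma : ∀ d a → + 0 - a ≡ + 0 * d + - + 1 * a
    lemma = solve-∀

  Tr-laplacian : ∀ k → Tr (matPow (laplacian G) k) ≡ Tr (matPow signless k) - + 2 * Tr (odd k)
  Tr-laplacian k = begin
    Tr (matPow (laplacian G) k)              ≡⟨ Tr-cong (matPow-cong laplacian-signed k) ⟩
    Tr (matPow (signed (- + 1)) k)           ≡⟨ Tr-signed (- + 1) refl k ⟩
    Tr (even k) + - + 1 * Tr (odd k)         ≡⟨ lemma (Tr (even k)) (Tr (odd k)) ⟩
    (Tr (even k) + + 1 * Tr (odd k)) - + 2 * Tr (odd k)
      ≡⟨ cong (_- + 2 * Tr (odd k)) (Tr-signed (+ 1) refl k) ⟨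
    Tr (matPow (signed (+ 1)) k) - + 2 * Tr (odd k)
      ≡⟨ cong (_- + 2 * Tr (odd k)) (Tr-cong (matPow-cong signless-signed k)) ⟨
    Tr (matPow signless k) - + 2 * Tr (odd k) ∎
    where
    open ≡-Reasoning
    lemma : ∀ e o → e + - + 1 * o ≡ (e + + 1 * o) - + 2 * o
    lemma = solve-∀

  x*0+y : ∀ x y → x * + 0 + y ≡ y
  x*0+y = solve-∀

  odd₁ : odd 1 ≋ A
  odd₁ i j = trans (x*0+y (deg i) ((A ⊙ idMat) i j)) (⊙-identityʳ A i j)

  even₁ : ∀ i j → even 1 i j ≡ deg i * idMat i j
  even₁ i j = trans (+-congˡ (deg i * idMat i j) (sum-zero λ l → ℤ.*-zeroʳ (A i l))) (ℤ.+-identityʳ (deg i * idMat i j))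

  A-diagonal : ∀ (d : Fin n → ℤ) i → sumℤ (λ l → A i l * (d l * idMat l i)) ≡ + 0
  A-diagonal d i = trans (sum-cong λ l → sym (ℤ.*-assoc (A i l) (d l) (idMat l i)))
    (trans (sum-idMatʳ i (λ l → A i l * d l)) (trans (cong (_* d i) (A-irrefl i)) (ℤ.*-zeroˡ (d i))))

  Tr-odd₁ : Tr (odd 1) ≡ + 0
  Tr-odd₁ = sum-zero λ i → trans (odd₁ i i) (A-irrefl i)

  odd₂-diagonal : ∀ i → odd 2 i i ≡ + 0
  odd₂-diagonal i = trans (cong₂ _+_ (cong (deg i *_) (trans (odd₁ i i) (A-irrefl i)))
      (trans (sum-cong λ l → cong (A i l *_) (even₁ l i)) (A-diagonal deg i)))
    (x*0+y (deg i) (+ 0))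

  Tr-odd₂ : Tr (odd 2) ≡ + 0
  Tr-odd₂ = sum-zero odd₂-diagonal

  even₂ : ∀ i j → even 2 i j ≡ (deg i * deg i) * idMat i j + (A ⊙ A) i j
  even₂ i j = cong₂ _+_ (trans (cong (deg i *_) (even₁ i j)) (sym (ℤ.*-assoc (deg i) (deg i) (idMat i j))))
    (⊙-congˡ A odd₁ i j)

  Tr-odd₃ : Tr (odd 3) ≡ trA G 3
  Tr-odd₃ = trans (sum-cong diagonal) (Tr-cong (⊙-congˡ A (⊙-congˡ A (≋-sym (⊙-identityʳ A)))))
    where
    diagonal : ∀ i → odd 3 i i ≡ (A ⊙ (A ⊙ A)) i i
    diagonal i = begin
      deg i * odd 2 i i + (A ⊙ even 2) i i
        ≡⟨ trans (cong (λ x → deg i * x + (A ⊙ even 2) i i) (odd₂-diagonal i)) (x*0+y (deg i) ((A ⊙ even 2) i i)) ⟩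
      (A ⊙ even 2) i i
        ≡⟨ sum-cong (λ l → trans (cong (A i l *_) (even₂ l i))
             (ℤ.*-distribˡ-+ (A i l) ((deg l * deg l) * idMat l i) ((A ⊙ A) l i))) ⟩
      sumℤ (λ l → A i l * ((deg l * deg l) * idMat l i) + A i l * (A ⊙ A) l i)
        ≡⟨ sum-+ (λ l → A i l * ((deg l * deg l) * idMat l i)) (λ l → A i l * (A ⊙ A) l i) ⟩
      sumℤ (λ l → A i l * ((deg l * deg l) * idMat l i)) + (A ⊙ (A ⊙ A)) i i
        ≡⟨ trans (cong (_+ (A ⊙ (A ⊙ A)) i i) (A-diagonal (λ l → deg l * deg l) i)) (ℤ.+-identityˡ ((A ⊙ (A ⊙ A)) i i)) ⟩
      (A ⊙ (A ⊙ A)) i i ∎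
      where open ≡-Reasoning

  Tr-signless₁ : Tr (matPow signless 1) ≡ trA G 2
  Tr-signless₁ = sum-cong λ i → trans (⊙-identityʳ signless i i) (trans (diagonal i) (sym (square i)))
    where
    diagonal : ∀ i → signless i i ≡ deg i
    diagonal i = trans (cong₂ (λ x y → x * deg i + y) (idMat-refl i) (A-irrefl i)) (lemma (deg i))
      where
      lemma : ∀ d → + 1 * d + + 0 ≡ d
      lemma = solve-∀
    idempotent : ∀ b → b2ℤ b * b2ℤ b ≡ b2ℤ b
    idempotent true  = refl
    idempotent false = refl
    square : ∀ i → matPow A 2 i i ≡ deg i
    square i = sum-cong λ j →
      trans (cong (A i j *_) (trans (⊙-identityʳ A j i) (A-sym j i))) (idempotent (adj G i j))

-- Walks in forests

parity : ℕ → Bool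
parity zero    = false
parity (suc k) = not (parity k)

module Walks {n} (G : Graph n) where

  data Walk : Fin n → Fin n → Bool → Set where
    nil  : ∀ {u} → Walk u u false
    cons : ∀ {u v w b} → adj G u v ≡ true → Walk v w b → Walk u w (not b)

  record Path (u w : Fin n) (b : Bool) : Set where
    field
      len   : ℕ
      v     : Fin (suc len) → Fin n
      start : v zero ≡ u
      stop  : v (fromℕ len) ≡ w
      inj   : ∀ i j → v i ≡ v j → i ≡ j
      step  : ∀ i j → toℕ j ≡ suc (toℕ i) → adj G (v i) (v j) ≡ true
      par   : parity len ≡ b

  -- If the new vertex u already lies on the path, then either u was left along the
  -- edge by which the path returns to it, or the path closes up to a cycle.
  extend : Forest G → ∀ {u v w b} → adj G u v ≡ true → Path v w b → Path u w (not b)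
  extend acyclic {u} {v} uv record { len = len ; v = f ; start = start ; stop = stop ; inj = inj ; step = step ; par = par }
    with Fin.any? (λ i → f i Fin.≟ u)
  ... | no fresh = record
    { len = suc len ; v = g ; start = refl ; stop = stop ; inj = g-inj ; step = g-step ; par = cong not par }
    where
    g : Fin (suc (suc len)) → Fin n
    g zero    = u
    g (suc i) = f i
    g-inj : ∀ i j → g i ≡ g j → i ≡ j
    g-inj zero    zero    eq = refl
    g-inj zero    (suc j) eq = contradiction (j , sym eq) fresh
    g-inj (suc i) zero    eq = contradiction (i , eq) fresh
    g-inj (suc i) (suc j) eq = cong suc (inj i j eq)
    g-step : ∀ i j → toℕ j ≡ suc (toℕ i) → adj G (g i) (g j) ≡ true
    g-step zero    (suc zero) eq = subst (λ x → adj G u x ≡ true) (sym start) uv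
    g-step (suc i) (suc j)    eq = step i j (ℕ.suc-injective eq)
  ... | yes (zero , eq) =
    contradiction (trans (sym (irrefl G u)) (subst (λ x → adj G u x ≡ true) (trans (sym start) eq) uv)) λ ()
  extend acyclic {u} {v} uv record { len = suc len ; v = f ; start = start ; stop = stop ; inj = inj ; step = step ; par = par }
      | yes (suc zero , eq) = record
    { len = len ; v = f ∘ suc ; start = eq ; stop = stop
    ; inj = λ i j e → Fin.suc-injective (inj (suc i) (suc j) e)
    ; step = λ i j e → step (suc i) (suc j) (cong suc e)
    ; par = trans (sym (Bool.not-involutive (parity len))) (cong not par) }
  extend acyclic {u} {v} uv record { len = suc (suc len) ; v = f ; start = start ; stop = stop ; inj = inj ; step = step ; par = par }
      | yes (suc (suc i) , eq) = contradiction cycle acyclic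
    where
    le : 3 ℕ.+ toℕ i ℕ.≤ 3 ℕ.+ len
    le = Fin.toℕ<n (suc (suc i))
    g : Fin (3 ℕ.+ toℕ i) → Fin n
    g j = f (inject≤ j le)
    last≡ : inject≤ (fromℕ (2 ℕ.+ toℕ i)) le ≡ suc (suc i)
    last≡ = Fin.toℕ-injective (trans (Fin.toℕ-inject≤ (fromℕ (2 ℕ.+ toℕ i)) le) (Fin.toℕ-fromℕ (2 ℕ.+ toℕ i)))
    cycle : Cycle G
    cycle = record
      { len₋₃ = toℕ i
      ; v     = g
      ; inj   = λ a b e → Fin.inject≤-injective le le a b (inj _ _ e)
      ; step  = λ a → step _ _ (trans (Fin.toℕ-inject≤ (suc a) le)
                  (cong suc (sym (trans (Fin.toℕ-inject≤ (inject₁ a) le) (Fin.toℕ-inject₁ a)))))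
      ; close = subst₂ (λ x y → adj G x y ≡ true) (sym (trans (cong f last≡) eq)) (sym start) uv
      }

  toPath : Forest G → ∀ {u w b} → Walk u w b → Path u w b
  toPath acyclic {u} nil = record
    { len = 0 ; v = const u ; start = refl ; stop = refl
    ; inj = λ { zero zero _ → refl } ; step = λ { zero zero () } ; par = refl }
  toPath acyclic (cons uv p) = extend acyclic uv (toPath acyclic p)

  no-odd-closed-walk : Forest G → ∀ {u} → ¬ Walk u u true
  no-odd-closed-walk acyclic p with toPath acyclic p
  ... | record { len = zero ; par = () }
  ... | record { len = suc k ; v = v ; start = start ; stop = stop ; inj = inj }
    with () ← inj zero (fromℕ (suc k)) (trans start (sym stop))

  open Incidence G
  open Parity G

  even-vanishes : ∀ k i j → ¬ Walk i j false → even k i j ≡ + 0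
  odd-vanishes  : ∀ k i j → ¬ Walk i j true → odd k i j ≡ + 0

  private
    A-times : ∀ {b} i j (Y : Mat n) → (∀ l → ¬ Walk l j b → Y l j ≡ + 0) → ¬ Walk i j (not b) → (A ⊙ Y) i j ≡ + 0
    A-times i j Y vanishes none = sum-zero term
      where
      term : ∀ l → A i l * Y l j ≡ + 0
      term l with adj G i l in eq
      ... | true  = trans (ℤ.*-identityˡ (Y l j)) (vanishes l (none ∘ cons eq))
      ... | false = ℤ.*-zeroˡ (Y l j)

    combine : ∀ d {x y} → x ≡ + 0 → y ≡ + 0 → d * x + y ≡ + 0
    combine d refl refl = x*0+y d (+ 0)

  even-vanishes zero    i j none = idMat-≢ λ { refl → none nil }
  even-vanishes (suc k) i j none =
    combine (deg i) (even-vanishes k i j none) (A-times i j (odd k) (λ l → odd-vanishes k l j) none)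
  odd-vanishes zero    i j none = refl
  odd-vanishes (suc k) i j none =
    combine (deg i) (odd-vanishes k i j none) (A-times i j (even k) (λ l → even-vanishes k l j) none)

  Tr-odd : Forest G → ∀ k → Tr (odd k) ≡ + 0
  Tr-odd acyclic k = sum-zero λ i → odd-vanishes k i i (no-odd-closed-walk acyclic)

-- elementaryₖ is k! times the k-th elementary symmetric polynomial of the variables
-- whose power sums are t, powerSum₂, powerSum₃, …

elementary₂ : ℤ → ℤ → ℤ
elementary₂ t s2 =
  fallProd t 2 - s2

elementary₃ : ℤ → ℤ → ℤ → ℤ
elementary₃ t s2 s3 =
  fallProd t 3 - + 3 * t * s2 + (+ 12 * s2 + + 2 * s3)

elementary₄ : ℤ → ℤ → ℤ → ℤ → ℤ
elementary₄ t s2 s3 s4 =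
  fallProd t 4 - + 6 * (t * t) * s2 + t * (+ 60 * s2 + + 8 * s3)
    - (+ 144 * s2 + + 48 * s3 + + 6 * s4) + + 3 * (s2 * s2)

elementary₅ : ℤ → ℤ → ℤ → ℤ → ℤ → ℤ
elementary₅ t s2 s3 s4 s5 =
  fallProd t 5 - + 10 * (t * t * t) * s2
    + (t * t) * (+ 180 * s2 + + 20 * s3)
    - t * (+ 1040 * s2 + + 280 * s3 + + 30 * s4)
    + + 15 * t * (s2 * s2)
    - s2 * (+ 120 * s2 + + 20 * s3)
    + (+ 1920 * s2 + + 960 * s3 + + 240 * s4 + + 24 * s5)

elementary₆ : ℤ → ℤ → ℤ → ℤ → ℤ → ℤ → ℤ
elementary₆ t s2 s3 s4 s5 s6 =
  fallProd t 6 - + 15 * (t * t * t * t) * s2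
    + (t * t * t) * (+ 420 * s2 + + 40 * s3)
    - (t * t) * (+ 4260 * s2 + + 960 * s3 + + 90 * s4)
    + + 45 * ((t * s2) * (t * s2))
    - + 810 * t * (s2 * s2)
    + t * (+ 18480 * s2 + + 7520 * s3 + + 1620 * s4 + + 144 * s5)
    - + 15 * (s2 * s2 * s2)
    + + 3600 * (s2 * s2)
    - + 28800 * s2
    + s2 * (+ 1200 * s3 + + 90 * s4)
    + + 40 * (s3 * s3)
    - + 120 * t * s2 * s3
    - (+ 19200 * s3 + + 7200 * s4 + + 1440 * s5 + + 120 * s6)

powerSum₂ : ℤ → ℤ → ℤ
powerSum₂ t s2 = + 2 * t + s2

powerSum₃ : ℤ → ℤ → ℤ → ℤ
powerSum₃ t s2 s3 = + 4 * t + + 6 * s2 + s3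

powerSum₄ : ℤ → ℤ → ℤ → ℤ → ℤ
powerSum₄ t s2 s3 s4 = + 8 * t + + 24 * s2 + + 8 * s3 + s4

powerSum₅ : ℤ → ℤ → ℤ → ℤ → ℤ → ℤ
powerSum₅ t s2 s3 s4 s5 = + 16 * t + + 80 * s2 + + 40 * s3 + + 10 * s4 + s5

powerSum₆ : ℤ → ℤ → ℤ → ℤ → ℤ → ℤ → ℤ
powerSum₆ t s2 s3 s4 s5 s6 = + 32 * t + + 240 * s2 + + 160 * s3 + + 60 * s4 + + 12 * s5 + s6

recurrence₂ : ∀ t s2 →
    t * t
    - powerSum₂ t s2
  ≡ elementary₂ t s2
recurrence₂ = ring
  where
  ring : ∀ t s2 →
    t * t
      - (+ 2 * t + s2)
      ≡ + 1 * (t - + 0) * (t - + 2) - s2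
  ring = solve-∀

recurrence₃ : ∀ t s2 s3 →
    t * elementary₂ t s2
    - + 2 * powerSum₂ t s2 * t
    + + 2 * powerSum₃ t s2 s3
  ≡ elementary₃ t s2 s3
recurrence₃ = ring
  where
  ring : ∀ t s2 s3 →
    t * (+ 1 * (t - + 0) * (t - + 2) - s2)
      - + 2 * (+ 2 * t + s2) * t
      + + 2 * (+ 4 * t + + 6 * s2 + s3)
      ≡ + 1 * (t - + 0) * (t - + 2) * (t - + 4) - + 3 * t * s2 + (+ 12 * s2 + + 2 * s3)
  ring = solve-∀

recurrence₄ : ∀ t s2 s3 s4 →
    t * elementary₃ t s2 s3
    - + 3 * powerSum₂ t s2 * elementary₂ t s2
    + + 6 * powerSum₃ t s2 s3 * t
    - + 6 * powerSum₄ t s2 s3 s4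
  ≡ elementary₄ t s2 s3 s4
recurrence₄ = ring
  where
  ring : ∀ t s2 s3 s4 →
    t * (+ 1 * (t - + 0) * (t - + 2) * (t - + 4) - + 3 * t * s2 + (+ 12 * s2 + + 2 * s3))
      - + 3 * (+ 2 * t + s2) * (+ 1 * (t - + 0) * (t - + 2) - s2)
      + + 6 * (+ 4 * t + + 6 * s2 + s3) * t
      - + 6 * (+ 8 * t + + 24 * s2 + + 8 * s3 + s4)
      ≡ + 1 * (t - + 0) * (t - + 2) * (t - + 4) * (t - + 6) - + 6 * (t * t) * s2 + t * (+ 60 * s2 + + 8 * s3)
      - (+ 144 * s2 + + 48 * s3 + + 6 * s4) + + 3 * (s2 * s2)
  ring = solve-∀

recurrence₅ : ∀ t s2 s3 s4 s5 →
    t * elementary₄ t s2 s3 s4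
    - + 4 * powerSum₂ t s2 * elementary₃ t s2 s3
    + + 12 * powerSum₃ t s2 s3 * elementary₂ t s2
    - + 24 * powerSum₄ t s2 s3 s4 * t
    + + 24 * powerSum₅ t s2 s3 s4 s5
  ≡ elementary₅ t s2 s3 s4 s5
recurrence₅ = ring
  where
  ring : ∀ t s2 s3 s4 s5 →
    t * (+ 1 * (t - + 0) * (t - + 2) * (t - + 4) * (t - + 6) - + 6 * (t * t) * s2 + t * (+ 60 * s2 + + 8 * s3)
      - (+ 144 * s2 + + 48 * s3 + + 6 * s4) + + 3 * (s2 * s2))
      - + 4 * (+ 2 * t + s2) * (+ 1 * (t - + 0) * (t - + 2) * (t - + 4) - + 3 * t * s2 + (+ 12 * s2 + + 2 * s3))
      + + 12 * (+ 4 * t + + 6 * s2 + s3) * (+ 1 * (t - + 0) * (t - + 2) - s2)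
      - + 24 * (+ 8 * t + + 24 * s2 + + 8 * s3 + s4) * t
      + + 24 * (+ 16 * t + + 80 * s2 + + 40 * s3 + + 10 * s4 + s5)
      ≡ + 1 * (t - + 0) * (t - + 2) * (t - + 4) * (t - + 6) * (t - + 8) - + 10 * (t * t * t) * s2
      + (t * t) * (+ 180 * s2 + + 20 * s3)
      - t * (+ 1040 * s2 + + 280 * s3 + + 30 * s4)
      + + 15 * t * (s2 * s2)
      - s2 * (+ 120 * s2 + + 20 * s3)
      + (+ 1920 * s2 + + 960 * s3 + + 240 * s4 + + 24 * s5)
  ring = solve-∀

recurrence₆ : ∀ t s2 s3 s4 s5 s6 →
    t * elementary₅ t s2 s3 s4 s5
    - + 5 * powerSum₂ t s2 * elementary₄ t s2 s3 s4
    + + 20 * powerSum₃ t s2 s3 * elementary₃ t s2 s3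
    - + 60 * powerSum₄ t s2 s3 s4 * elementary₂ t s2
    + + 120 * powerSum₅ t s2 s3 s4 s5 * t
    - + 120 * powerSum₆ t s2 s3 s4 s5 s6
  ≡ elementary₆ t s2 s3 s4 s5 s6
recurrence₆ = ring
  where
  ring : ∀ t s2 s3 s4 s5 s6 →
    t * (+ 1 * (t - + 0) * (t - + 2) * (t - + 4) * (t - + 6) * (t - + 8) - + 10 * (t * t * t) * s2
      + (t * t) * (+ 180 * s2 + + 20 * s3)
      - t * (+ 1040 * s2 + + 280 * s3 + + 30 * s4)
      + + 15 * t * (s2 * s2)
      - s2 * (+ 120 * s2 + + 20 * s3)
      + (+ 1920 * s2 + + 960 * s3 + + 240 * s4 + + 24 * s5))
      - + 5 * (+ 2 * t + s2) * (+ 1 * (t - + 0) * (t - + 2) * (t - + 4) * (t - + 6) - + 6 * (t * t) * s2 + t * (+ 60 * s2 + + 8 * s3)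
      - (+ 144 * s2 + + 48 * s3 + + 6 * s4) + + 3 * (s2 * s2))
      + + 20 * (+ 4 * t + + 6 * s2 + s3) * (+ 1 * (t - + 0) * (t - + 2) * (t - + 4) - + 3 * t * s2 + (+ 12 * s2 + + 2 * s3))
      - + 60 * (+ 8 * t + + 24 * s2 + + 8 * s3 + s4) * (+ 1 * (t - + 0) * (t - + 2) - s2)
      + + 120 * (+ 16 * t + + 80 * s2 + + 40 * s3 + + 10 * s4 + s5) * t
      - + 120 * (+ 32 * t + + 240 * s2 + + 160 * s3 + + 60 * s4 + + 12 * s5 + s6)
      ≡ + 1 * (t - + 0) * (t - + 2) * (t - + 4) * (t - + 6) * (t - + 8) * (t - + 10) - + 15 * (t * t * t * t) * s2
      + (t * t * t) * (+ 420 * s2 + + 40 * s3)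
      - (t * t) * (+ 4260 * s2 + + 960 * s3 + + 90 * s4)
      + + 45 * ((t * s2) * (t * s2))
      - + 810 * t * (s2 * s2)
      + t * (+ 18480 * s2 + + 7520 * s3 + + 1620 * s4 + + 144 * s5)
      - + 15 * (s2 * s2 * s2)
      + + 3600 * (s2 * s2)
      - + 28800 * s2
      + s2 * (+ 1200 * s3 + + 90 * s4)
      + + 40 * (s3 * s3)
      - + 120 * t * s2 * s3
      - (+ 19200 * s3 + + 7200 * s4 + + 1440 * s5 + + 120 * s6)
  ring = solve-∀

-- Stated for variables: with traces substituted, checking this conversion is infeasible.

elementary₄-unfold : ∀ t s2 s3 s4 → elementary₄ t s2 s3 s4 ≡
    fallProd t 4 - + 6 * (t * t) * s2 + t * (+ 60 * s2 + + 8 * s3)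
    - (+ 144 * s2 + + 48 * s3 + + 6 * s4) + + 3 * (s2 * s2)
elementary₄-unfold _ _ _ _ = refl

elementary₅-unfold : ∀ t s2 s3 s4 s5 → elementary₅ t s2 s3 s4 s5 ≡
    fallProd t 5 - + 10 * (t * t * t) * s2
    + (t * t) * (+ 180 * s2 + + 20 * s3)
    - t * (+ 1040 * s2 + + 280 * s3 + + 30 * s4)
    + + 15 * t * (s2 * s2)
    - s2 * (+ 120 * s2 + + 20 * s3)
    + (+ 1920 * s2 + + 960 * s3 + + 240 * s4 + + 24 * s5)
elementary₅-unfold _ _ _ _ _ = refl

elementary₆-unfold : ∀ t s2 s3 s4 s5 s6 → elementary₆ t s2 s3 s4 s5 s6 ≡
    fallProd t 6 - + 15 * (t * t * t * t) * s2
    + (t * t * t) * (+ 420 * s2 + + 40 * s3)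
    - (t * t) * (+ 4260 * s2 + + 960 * s3 + + 90 * s4)
    + + 45 * ((t * s2) * (t * s2))
    - + 810 * t * (s2 * s2)
    + t * (+ 18480 * s2 + + 7520 * s3 + + 1620 * s4 + + 144 * s5)
    - + 15 * (s2 * s2 * s2)
    + + 3600 * (s2 * s2)
    - + 28800 * s2
    + s2 * (+ 1200 * s3 + + 90 * s4)
    + + 40 * (s3 * s3)
    - + 120 * t * s2 * s3
    - (+ 19200 * s3 + + 7200 * s4 + + 1440 * s5 + + 120 * s6)
elementary₆-unfold _ _ _ _ _ _ = refl

newton-scaled₃ : ∀ {c₁ c₂ c₃ x₁ x₂ x₃ y₁ y₂ y₃ F₂} →
  + 3 * c₃ ≡ c₂ * x₁ - c₁ * x₂ + x₃ →
  + 2 * c₂ ≡ F₂ → c₁ ≡ y₁ → x₁ ≡ y₁ → x₂ ≡ y₂ → x₃ ≡ y₃ →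
  + 6 * c₃ ≡ y₁ * F₂ - + 2 * y₂ * y₁ + + 2 * y₃
newton-scaled₃ {c₁} {c₂} {c₃} {x₂ = x₂} {x₃} eq refl refl refl refl refl =
  trans (left c₃) (trans (cong (λ z → + 2 * z) eq) (right c₁ c₂ x₂ x₃))
  where
  left : ∀ c → + 6 * c ≡ + 2 * (+ 3 * c)
  left = solve-∀
  right : ∀ c₁ c₂ x₂ x₃ → + 2 * (c₂ * c₁ - c₁ * x₂ + x₃) ≡ c₁ * (+ 2 * c₂) - + 2 * x₂ * c₁ + + 2 * x₃
  right = solve-∀

newton-scaled₄ : ∀ {c₁ c₂ c₃ c₄ x₁ x₂ x₃ x₄ y₁ y₂ y₃ y₄ F₂ F₃} →
  + 4 * c₄ ≡ c₃ * x₁ - c₂ * x₂ + c₁ * x₃ - x₄ →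
  + 6 * c₃ ≡ F₃ → + 2 * c₂ ≡ F₂ → c₁ ≡ y₁ →
  x₁ ≡ y₁ → x₂ ≡ y₂ → x₃ ≡ y₃ → x₄ ≡ y₄ →
  + 24 * c₄ ≡ y₁ * F₃ - + 3 * y₂ * F₂ + + 6 * y₃ * y₁ - + 6 * y₄
newton-scaled₄ {c₁} {c₂} {c₃} {c₄} {x₂ = x₂} {x₃} {x₄} eq refl refl refl refl refl refl refl =
  trans (left c₄) (trans (cong (λ z → + 6 * z) eq) (right c₁ c₂ c₃ x₂ x₃ x₄))
  where
  left : ∀ c → + 24 * c ≡ + 6 * (+ 4 * c)
  left = solve-∀
  right : ∀ c₁ c₂ c₃ x₂ x₃ x₄ → + 6 * (c₃ * c₁ - c₂ * x₂ + c₁ * x₃ - x₄) ≡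
    c₁ * (+ 6 * c₃) - + 3 * x₂ * (+ 2 * c₂) + + 6 * x₃ * c₁ - + 6 * x₄
  right = solve-∀

newton-scaled₅ : ∀ {c₁ c₂ c₃ c₄ c₅ x₁ x₂ x₃ x₄ x₅ y₁ y₂ y₃ y₄ y₅ F₂ F₃ F₄} →
  + 5 * c₅ ≡ c₄ * x₁ - c₃ * x₂ + c₂ * x₃ - c₁ * x₄ + x₅ →
  + 24 * c₄ ≡ F₄ → + 6 * c₃ ≡ F₃ → + 2 * c₂ ≡ F₂ → c₁ ≡ y₁ →
  x₁ ≡ y₁ → x₂ ≡ y₂ → x₃ ≡ y₃ → x₄ ≡ y₄ → x₅ ≡ y₅ →
  + 120 * c₅ ≡ y₁ * F₄ - + 4 * y₂ * F₃ + + 12 * y₃ * F₂ - + 24 * y₄ * y₁ + + 24 * y₅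
newton-scaled₅ {c₁} {c₂} {c₃} {c₄} {c₅} {x₂ = x₂} {x₃} {x₄} {x₅} eq refl refl refl refl refl refl refl refl refl =
  trans (left c₅) (trans (cong (λ z → + 24 * z) eq) (right c₁ c₂ c₃ c₄ x₂ x₃ x₄ x₅))
  where
  left : ∀ c → + 120 * c ≡ + 24 * (+ 5 * c)
  left = solve-∀
  right : ∀ c₁ c₂ c₃ c₄ x₂ x₃ x₄ x₅ → + 24 * (c₄ * c₁ - c₃ * x₂ + c₂ * x₃ - c₁ * x₄ + x₅) ≡
    c₁ * (+ 24 * c₄) - + 4 * x₂ * (+ 6 * c₃) + + 12 * x₃ * (+ 2 * c₂) - + 24 * x₄ * c₁ + + 24 * x₅
  right = solve-∀

newton-scaled₆ : ∀ {c₁ c₂ c₃ c₄ c₅ c₆ x₁ x₂ x₃ x₄ x₅ x₆ y₁ y₂ y₃ y₄ y₅ y₆ F₂ F₃ F₄ F₅} →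
  + 6 * c₆ ≡ c₅ * x₁ - c₄ * x₂ + c₃ * x₃ - c₂ * x₄ + c₁ * x₅ - x₆ →
  + 120 * c₅ ≡ F₅ → + 24 * c₄ ≡ F₄ → + 6 * c₃ ≡ F₃ → + 2 * c₂ ≡ F₂ → c₁ ≡ y₁ →
  x₁ ≡ y₁ → x₂ ≡ y₂ → x₃ ≡ y₃ → x₄ ≡ y₄ → x₅ ≡ y₅ → x₆ ≡ y₆ →
  + 720 * c₆ ≡ y₁ * F₅ - + 5 * y₂ * F₄ + + 20 * y₃ * F₃ - + 60 * y₄ * F₂ + + 120 * y₅ * y₁ - + 120 * y₆
newton-scaled₆ {c₁} {c₂} {c₃} {c₄} {c₅} {c₆} {x₂ = x₂} {x₃} {x₄} {x₅} {x₆}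
  eq refl refl refl refl refl refl refl refl refl refl refl =
  trans (left c₆) (trans (cong (λ z → + 120 * z) eq) (right c₁ c₂ c₃ c₄ c₅ x₂ x₃ x₄ x₅ x₆))
  where
  left : ∀ c → + 720 * c ≡ + 120 * (+ 6 * c)
  left = solve-∀
  right : ∀ c₁ c₂ c₃ c₄ c₅ x₂ x₃ x₄ x₅ x₆ →
    + 120 * (c₅ * c₁ - c₄ * x₂ + c₃ * x₃ - c₂ * x₄ + c₁ * x₅ - x₆) ≡
    c₁ * (+ 120 * c₅) - + 5 * x₂ * (+ 24 * c₄) + + 20 * x₃ * (+ 6 * c₃) - + 60 * x₄ * (+ 2 * c₂)
      + + 120 * x₅ * c₁ - + 120 * x₆
  right = solve-∀

newton-elementary₄ : ∀ (c x s : ℕ → ℤ) t → + 4 * c 4 ≡ c 3 * x 1 - c 2 * x 2 + c 1 * x 3 - x 4 →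
  + 6 * c 3 ≡ elementary₃ t (s 2) (s 3) → + 2 * c 2 ≡ elementary₂ t (s 2) → c 1 ≡ t →
  x 1 ≡ t → x 2 ≡ powerSum₂ t (s 2) → x 3 ≡ powerSum₃ t (s 2) (s 3) → x 4 ≡ powerSum₄ t (s 2) (s 3) (s 4) →
  + 24 * c 4 ≡ elementary₄ t (s 2) (s 3) (s 4)
newton-elementary₄ c x s t newton c₃ c₂ c₁ x₁ x₂ x₃ x₄ =
  trans (newton-scaled₄ newton c₃ c₂ c₁ x₁ x₂ x₃ x₄) (recurrence₄ t (s 2) (s 3) (s 4))

newton-elementary₅ : ∀ (c x s : ℕ → ℤ) t → + 5 * c 5 ≡ c 4 * x 1 - c 3 * x 2 + c 2 * x 3 - c 1 * x 4 + x 5 →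
  + 24 * c 4 ≡ elementary₄ t (s 2) (s 3) (s 4) → + 6 * c 3 ≡ elementary₃ t (s 2) (s 3) → + 2 * c 2 ≡ elementary₂ t (s 2) → c 1 ≡ t →
  x 1 ≡ t → x 2 ≡ powerSum₂ t (s 2) → x 3 ≡ powerSum₃ t (s 2) (s 3) → x 4 ≡ powerSum₄ t (s 2) (s 3) (s 4) →
  x 5 ≡ powerSum₅ t (s 2) (s 3) (s 4) (s 5) →
  + 120 * c 5 ≡ elementary₅ t (s 2) (s 3) (s 4) (s 5)
newton-elementary₅ c x s t newton c₄ c₃ c₂ c₁ x₁ x₂ x₃ x₄ x₅ =
  trans (newton-scaled₅ newton c₄ c₃ c₂ c₁ x₁ x₂ x₃ x₄ x₅) (recurrence₅ t (s 2) (s 3) (s 4) (s 5))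

newton-elementary₆ : ∀ (c x s : ℕ → ℤ) t → + 6 * c 6 ≡ c 5 * x 1 - c 4 * x 2 + c 3 * x 3 - c 2 * x 4 + c 1 * x 5 - x 6 →
  + 120 * c 5 ≡ elementary₅ t (s 2) (s 3) (s 4) (s 5) → + 24 * c 4 ≡ elementary₄ t (s 2) (s 3) (s 4) →
  + 6 * c 3 ≡ elementary₃ t (s 2) (s 3) → + 2 * c 2 ≡ elementary₂ t (s 2) → c 1 ≡ t →
  x 1 ≡ t → x 2 ≡ powerSum₂ t (s 2) → x 3 ≡ powerSum₃ t (s 2) (s 3) → x 4 ≡ powerSum₄ t (s 2) (s 3) (s 4) →
  x 5 ≡ powerSum₅ t (s 2) (s 3) (s 4) (s 5) → x 6 ≡ powerSum₆ t (s 2) (s 3) (s 4) (s 5) (s 6) →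
  + 720 * c 6 ≡ elementary₆ t (s 2) (s 3) (s 4) (s 5) (s 6)
newton-elementary₆ c x s t newton c₅ c₄ c₃ c₂ c₁ x₁ x₂ x₃ x₄ x₅ x₆ =
  trans (newton-scaled₆ newton c₅ c₄ c₃ c₂ c₁ x₁ x₂ x₃ x₄ x₅ x₆) (recurrence₆ t (s 2) (s 3) (s 4) (s 5) (s 6))

module Expansion {m} (M : Mat m) (Tr-M : Tr (matPow M 1) ≡ + 0) where

  open Shift M

  s : ℕ → ℤ
  s j = Tr (matPow M j)

  mixed₂ : ∀ j → mixed 2 j ≡ + 4 * s j + + 4 * s (1 ℕ.+ j) + s (2 ℕ.+ j)
  mixed₂ j = ring (s j) (s (1 ℕ.+ j)) (s (2 ℕ.+ j))
    where
    ring : ∀ a b c → + 2 * (+ 2 * a + b) + (+ 2 * b + c) ≡ + 4 * a + + 4 * b + c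
    ring = solve-∀

  mixed₃ : ∀ j → mixed 3 j ≡ + 8 * s j + + 12 * s (1 ℕ.+ j) + + 6 * s (2 ℕ.+ j) + s (3 ℕ.+ j)
  mixed₃ j = trans (cong₂ (λ x y → + 2 * x + y) (mixed₂ j) (mixed₂ (suc j)))
    (ring (s j) (s (1 ℕ.+ j)) (s (2 ℕ.+ j)) (s (3 ℕ.+ j)))
    where
    ring : ∀ a b c d → + 2 * (+ 4 * a + + 4 * b + c) + (+ 4 * b + + 4 * c + d) ≡ + 8 * a + + 12 * b + + 6 * c + d
    ring = solve-∀

  mixed₄ : ∀ j → mixed 4 j ≡
    + 16 * s j + + 32 * s (1 ℕ.+ j) + + 24 * s (2 ℕ.+ j) + + 8 * s (3 ℕ.+ j) + s (4 ℕ.+ j)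
  mixed₄ j = trans (cong₂ (λ x y → + 2 * x + y) (mixed₃ j) (mixed₃ (suc j)))
    (ring (s j) (s (1 ℕ.+ j)) (s (2 ℕ.+ j)) (s (3 ℕ.+ j)) (s (4 ℕ.+ j)))
    where
    ring : ∀ a b c d e →
      + 2 * (+ 8 * a + + 12 * b + + 6 * c + d) + (+ 8 * b + + 12 * c + + 6 * d + e) ≡
      + 16 * a + + 32 * b + + 24 * c + + 8 * d + e
    ring = solve-∀

  mixed₅ : ∀ j → mixed 5 j ≡
    + 32 * s j + + 80 * s (1 ℕ.+ j) + + 80 * s (2 ℕ.+ j) + + 40 * s (3 ℕ.+ j) + + 10 * s (4 ℕ.+ j) + s (5 ℕ.+ j)
  mixed₅ j = trans (cong₂ (λ x y → + 2 * x + y) (mixed₄ j) (mixed₄ (suc j)))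
    (ring (s j) (s (1 ℕ.+ j)) (s (2 ℕ.+ j)) (s (3 ℕ.+ j)) (s (4 ℕ.+ j)) (s (5 ℕ.+ j)))
    where
    ring : ∀ a b c d e f →
      + 2 * (+ 16 * a + + 32 * b + + 24 * c + + 8 * d + e) + (+ 16 * b + + 32 * c + + 24 * d + + 8 * e + f) ≡
      + 32 * a + + 80 * b + + 80 * c + + 40 * d + + 10 * e + f
    ring = solve-∀

  mixed₆ : ∀ j → mixed 6 j ≡
    + 64 * s j + + 192 * s (1 ℕ.+ j) + + 240 * s (2 ℕ.+ j) + + 160 * s (3 ℕ.+ j) + + 60 * s (4 ℕ.+ j)
      + + 12 * s (5 ℕ.+ j) + s (6 ℕ.+ j)
  mixed₆ j = trans (cong₂ (λ x y → + 2 * x + y) (mixed₅ j) (mixed₅ (suc j)))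
    (ring (s j) (s (1 ℕ.+ j)) (s (2 ℕ.+ j)) (s (3 ℕ.+ j)) (s (4 ℕ.+ j)) (s (5 ℕ.+ j)) (s (6 ℕ.+ j)))
    where
    ring : ∀ a b c d e f g →
      + 2 * (+ 32 * a + + 80 * b + + 80 * c + + 40 * d + + 10 * e + f)
        + (+ 32 * b + + 80 * c + + 80 * d + + 40 * e + + 10 * f + g) ≡
      + 64 * a + + 192 * b + + 240 * c + + 160 * d + + 60 * e + + 12 * f + g
    ring = solve-∀

  t : ℤ
  t = mixed 1 0

  private
    substitute₀ : ∀ {b x y : ℤ} (f : ℤ → ℤ) (g : ℤ → ℤ) → b ≡ + 0 → x ≡ f b → f (+ 0) ≡ g (+ 0) → y ≡ g b → x ≡ y
    substitute₀ f g refl p q r = trans p (trans q (sym r))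

  Tr-shift₂ : mixed 2 0 ≡ powerSum₂ t (s 2)
  Tr-shift₂ = substitute₀ (λ b → + 4 * s 0 + + 4 * b + s 2) (λ b → powerSum₂ (+ 2 * s 0 + b) (s 2)) Tr-M (mixed₂ 0)
    (ring (s 0) (s 2)) refl
    where
    ring : ∀ a s2 → + 4 * a + + 4 * + 0 + s2 ≡ + 2 * (+ 2 * a + + 0) + s2
    ring = solve-∀

  Tr-shift₃ : mixed 3 0 ≡ powerSum₃ t (s 2) (s 3)
  Tr-shift₃ = substitute₀ (λ b → + 8 * s 0 + + 12 * b + + 6 * s 2 + s 3) (λ b → powerSum₃ (+ 2 * s 0 + b) (s 2) (s 3))
    Tr-M (mixed₃ 0) (ring (s 0) (s 2) (s 3)) refl
    where
    ring : ∀ a s2 s3 → + 8 * a + + 12 * + 0 + + 6 * s2 + s3 ≡ + 4 * (+ 2 * a + + 0) + + 6 * s2 + s3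
    ring = solve-∀

  Tr-shift₄ : mixed 4 0 ≡ powerSum₄ t (s 2) (s 3) (s 4)
  Tr-shift₄ = substitute₀ (λ b → + 16 * s 0 + + 32 * b + + 24 * s 2 + + 8 * s 3 + s 4)
    (λ b → powerSum₄ (+ 2 * s 0 + b) (s 2) (s 3) (s 4)) Tr-M (mixed₄ 0) (ring (s 0) (s 2) (s 3) (s 4)) refl
    where
    ring : ∀ a s2 s3 s4 → + 16 * a + + 32 * + 0 + + 24 * s2 + + 8 * s3 + s4 ≡
      + 8 * (+ 2 * a + + 0) + + 24 * s2 + + 8 * s3 + s4
    ring = solve-∀

  Tr-shift₅ : mixed 5 0 ≡ powerSum₅ t (s 2) (s 3) (s 4) (s 5)
  Tr-shift₅ = substitute₀ (λ b → + 32 * s 0 + + 80 * b + + 80 * s 2 + + 40 * s 3 + + 10 * s 4 + s 5)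
    (λ b → powerSum₅ (+ 2 * s 0 + b) (s 2) (s 3) (s 4) (s 5)) Tr-M (mixed₅ 0) (ring (s 0) (s 2) (s 3) (s 4) (s 5)) refl
    where
    ring : ∀ a s2 s3 s4 s5 → + 32 * a + + 80 * + 0 + + 80 * s2 + + 40 * s3 + + 10 * s4 + s5 ≡
      + 16 * (+ 2 * a + + 0) + + 80 * s2 + + 40 * s3 + + 10 * s4 + s5
    ring = solve-∀

  Tr-shift₆ : mixed 6 0 ≡ powerSum₆ t (s 2) (s 3) (s 4) (s 5) (s 6)
  Tr-shift₆ = substitute₀ (λ b → + 64 * s 0 + + 192 * b + + 240 * s 2 + + 160 * s 3 + + 60 * s 4 + + 12 * s 5 + s 6)
    (λ b → powerSum₆ (+ 2 * s 0 + b) (s 2) (s 3) (s 4) (s 5) (s 6)) Tr-M (mixed₆ 0)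
    (ring (s 0) (s 2) (s 3) (s 4) (s 5) (s 6)) refl
    where
    ring : ∀ a s2 s3 s4 s5 s6 →
      + 64 * a + + 192 * + 0 + + 240 * s2 + + 160 * s3 + + 60 * s4 + + 12 * s5 + s6 ≡
      + 32 * (+ 2 * a + + 0) + + 240 * s2 + + 160 * s3 + + 60 * s4 + + 12 * s5 + s6
    ring = solve-∀

module Coefficients {n} (G : Graph n) where

  open CharPoly (laplacian G)
  open Incidence G
  open Parity G
  open Walks G

  p : ℕ → ℤ
  p k = Tr (matPow (laplacian G) k)

  y : ℕ → ℤ
  y i = χ (n ∸ i)

  c≡ : ∀ i → i ≤ n → c G (n ∸ i) ≡ sgn i * y i
  c≡ i i≤n = cong (λ k → sgn k * y i) (ℕ.m∸[m∸n]≡n i≤n)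

  newton-c : ∀ i → i ≤ n → + i * c G (n ∸ i) ≡ - (sgn i * newtonSum i 1)
  newton-c i i≤n = trans (cong (λ x → + i * x) (c≡ i i≤n))
    (trans (ring (+ i) (sgn i) (y i)) (cong (λ x → - (sgn i * x)) (sym (newton i i≤n))))
    where
    ring : ∀ i s y → i * (s * y) ≡ - (s * (- i * y))
    ring = solve-∀

  y₀ : y 0 ≡ + 1
  y₀ = charPoly-monic (laplacian G)

  newton₁ : 1 ≤ n → c G (n ∸ 1) ≡ p 1
  newton₁ le = trans (sym (ℤ.*-identityˡ (c G (n ∸ 1)))) (trans (newton-c 1 le) (lemma (p 1) {y 0} y₀))
    where
    ring : ∀ p₁ → - (- + 1 * (+ 0 + + 1 * p₁)) ≡ p₁
    ring = solve-∀
    lemma : ∀ p₁ {y₀} → y₀ ≡ + 1 → - (- + 1 * (+ 0 + y₀ * p₁)) ≡ p₁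
    lemma p₁ refl = ring p₁

  newton₂ : 2 ≤ n → + 2 * c G (n ∸ 2) ≡ c G (n ∸ 1) * p 1 - p 2
  newton₂ le = trans (newton-c 2 le) (lemma (y 1) (p 1) (p 2) {y 0} {c G (n ∸ 1)} y₀ (c≡ 1 (ℕ.m+n≤o⇒m≤o 1 le)))
    where
    ring : ∀ y₁ p₁ p₂ → - (+ 1 * (+ 0 + + 1 * p₂ + y₁ * p₁)) ≡ (- + 1 * y₁) * p₁ - p₂
    ring = solve-∀
    lemma : ∀ y₁ p₁ p₂ {y₀ e₁} → y₀ ≡ + 1 → e₁ ≡ - + 1 * y₁ →
      - (+ 1 * (+ 0 + y₀ * p₂ + y₁ * p₁)) ≡ e₁ * p₁ - p₂
    lemma y₁ p₁ p₂ refl refl = ring y₁ p₁ p₂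

  newton₃ : 3 ≤ n → + 3 * c G (n ∸ 3) ≡ c G (n ∸ 2) * p 1 - c G (n ∸ 1) * p 2 + p 3
  newton₃ le = trans (newton-c 3 le) (lemma (y 1) (y 2) (p 1) (p 2) (p 3) {y 0} {c G (n ∸ 1)} {c G (n ∸ 2)} y₀
      (c≡ 1 (ℕ.m+n≤o⇒m≤o 1 le)) (c≡ 2 (ℕ.m+n≤o⇒m≤o 2 le)))
    where
    ring : ∀ y₁ y₂ p₁ p₂ p₃ → - (- + 1 * (+ 0 + + 1 * p₃ + y₁ * p₂ + y₂ * p₁)) ≡
      (+ 1 * y₂) * p₁ - (- + 1 * y₁) * p₂ + p₃
    ring = solve-∀
    lemma : ∀ y₁ y₂ p₁ p₂ p₃ {y₀ e₁ e₂} → y₀ ≡ + 1 → e₁ ≡ - + 1 * y₁ → e₂ ≡ + 1 * y₂ →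
      - (- + 1 * (+ 0 + y₀ * p₃ + y₁ * p₂ + y₂ * p₁)) ≡ e₂ * p₁ - e₁ * p₂ + p₃
    lemma y₁ y₂ p₁ p₂ p₃ refl refl refl = ring y₁ y₂ p₁ p₂ p₃

  newton₄ : 4 ≤ n → + 4 * c G (n ∸ 4) ≡ c G (n ∸ 3) * p 1 - c G (n ∸ 2) * p 2 + c G (n ∸ 1) * p 3 - p 4
  newton₄ le = trans (newton-c 4 le) (lemma (y 1) (y 2) (y 3) (p 1) (p 2) (p 3) (p 4) {y 0} {c G (n ∸ 1)} {c G (n ∸ 2)} {c G (n ∸ 3)} y₀
      (c≡ 1 (ℕ.m+n≤o⇒m≤o 1 le)) (c≡ 2 (ℕ.m+n≤o⇒m≤o 2 le)) (c≡ 3 (ℕ.m+n≤o⇒m≤o 3 le)))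
    where
    ring : ∀ y₁ y₂ y₃ p₁ p₂ p₃ p₄ → - (+ 1 * (+ 0 + + 1 * p₄ + y₁ * p₃ + y₂ * p₂ + y₃ * p₁)) ≡
      (- + 1 * y₃) * p₁ - (+ 1 * y₂) * p₂ + (- + 1 * y₁) * p₃ - p₄
    ring = solve-∀
    lemma : ∀ y₁ y₂ y₃ p₁ p₂ p₃ p₄ {y₀ e₁ e₂ e₃} →
      y₀ ≡ + 1 → e₁ ≡ - + 1 * y₁ → e₂ ≡ + 1 * y₂ → e₃ ≡ - + 1 * y₃ →
      - (+ 1 * (+ 0 + y₀ * p₄ + y₁ * p₃ + y₂ * p₂ + y₃ * p₁)) ≡ e₃ * p₁ - e₂ * p₂ + e₁ * p₃ - p₄
    lemma y₁ y₂ y₃ p₁ p₂ p₃ p₄ refl refl refl refl = ring y₁ y₂ y₃ p₁ p₂ p₃ p₄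

  newton₅ : 5 ≤ n → + 5 * c G (n ∸ 5) ≡ c G (n ∸ 4) * p 1 - c G (n ∸ 3) * p 2 + c G (n ∸ 2) * p 3 - c G (n ∸ 1) * p 4 + p 5
  newton₅ le = trans (newton-c 5 le) (lemma (y 1) (y 2) (y 3) (y 4) (p 1) (p 2) (p 3) (p 4) (p 5) {y 0} {c G (n ∸ 1)} {c G (n ∸ 2)} {c G (n ∸ 3)} {c G (n ∸ 4)} y₀
      (c≡ 1 (ℕ.m+n≤o⇒m≤o 1 le)) (c≡ 2 (ℕ.m+n≤o⇒m≤o 2 le)) (c≡ 3 (ℕ.m+n≤o⇒m≤o 3 le))
      (c≡ 4 (ℕ.m+n≤o⇒m≤o 4 le)))
    where
    ring : ∀ y₁ y₂ y₃ y₄ p₁ p₂ p₃ p₄ p₅ →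
      - (- + 1 * (+ 0 + + 1 * p₅ + y₁ * p₄ + y₂ * p₃ + y₃ * p₂ + y₄ * p₁)) ≡
      (+ 1 * y₄) * p₁ - (- + 1 * y₃) * p₂ + (+ 1 * y₂) * p₃ - (- + 1 * y₁) * p₄ + p₅
    ring = solve-∀
    lemma : ∀ y₁ y₂ y₃ y₄ p₁ p₂ p₃ p₄ p₅ {y₀ e₁ e₂ e₃ e₄} →
      y₀ ≡ + 1 → e₁ ≡ - + 1 * y₁ → e₂ ≡ + 1 * y₂ → e₃ ≡ - + 1 * y₃ → e₄ ≡ + 1 * y₄ →
      - (- + 1 * (+ 0 + y₀ * p₅ + y₁ * p₄ + y₂ * p₃ + y₃ * p₂ + y₄ * p₁)) ≡
      e₄ * p₁ - e₃ * p₂ + e₂ * p₃ - e₁ * p₄ + p₅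
    lemma y₁ y₂ y₃ y₄ p₁ p₂ p₃ p₄ p₅ refl refl refl refl refl = ring y₁ y₂ y₃ y₄ p₁ p₂ p₃ p₄ p₅

  newton₆ : 6 ≤ n → + 6 * c G (n ∸ 6) ≡ c G (n ∸ 5) * p 1 - c G (n ∸ 4) * p 2 + c G (n ∸ 3) * p 3 - c G (n ∸ 2) * p 4 + c G (n ∸ 1) * p 5 - p 6
  newton₆ le = trans (newton-c 6 le)
    (lemma (y 1) (y 2) (y 3) (y 4) (y 5) (p 1) (p 2) (p 3) (p 4) (p 5) (p 6) {y 0} {c G (n ∸ 1)} {c G (n ∸ 2)} {c G (n ∸ 3)} {c G (n ∸ 4)} {c G (n ∸ 5)} y₀
      (c≡ 1 (ℕ.m+n≤o⇒m≤o 1 le)) (c≡ 2 (ℕ.m+n≤o⇒m≤o 2 le)) (c≡ 3 (ℕ.m+n≤o⇒m≤o 3 le))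
      (c≡ 4 (ℕ.m+n≤o⇒m≤o 4 le)) (c≡ 5 (ℕ.m+n≤o⇒m≤o 5 le)))
    where
    ring : ∀ y₁ y₂ y₃ y₄ y₅ p₁ p₂ p₃ p₄ p₅ p₆ →
      - (+ 1 * (+ 0 + + 1 * p₆ + y₁ * p₅ + y₂ * p₄ + y₃ * p₃ + y₄ * p₂ + y₅ * p₁)) ≡
      (- + 1 * y₅) * p₁ - (+ 1 * y₄) * p₂ + (- + 1 * y₃) * p₃ - (+ 1 * y₂) * p₄ + (- + 1 * y₁) * p₅ - p₆
    ring = solve-∀
    lemma : ∀ y₁ y₂ y₃ y₄ y₅ p₁ p₂ p₃ p₄ p₅ p₆ {y₀ e₁ e₂ e₃ e₄ e₅} →
      y₀ ≡ + 1 → e₁ ≡ - + 1 * y₁ → e₂ ≡ + 1 * y₂ → e₃ ≡ - + 1 * y₃ → e₄ ≡ + 1 * y₄ → e₅ ≡ - + 1 * y₅ →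
      - (+ 1 * (+ 0 + y₀ * p₆ + y₁ * p₅ + y₂ * p₄ + y₃ * p₃ + y₄ * p₂ + y₅ * p₁)) ≡
      e₅ * p₁ - e₄ * p₂ + e₃ * p₃ - e₂ * p₄ + e₁ * p₅ - p₆
    lemma y₁ y₂ y₃ y₄ y₅ p₁ p₂ p₃ p₄ p₅ p₆ refl refl refl refl refl refl =
      ring y₁ y₂ y₃ y₄ y₅ p₁ p₂ p₃ p₄ p₅ p₆

  Tr-lineAdj : trA₁ G 1 ≡ + 0
  Tr-lineAdj = sum-zero λ f → trans (⊙-identityʳ (lineAdjMat G) f f) (loopless f)
    where
    loopless : ∀ f → lineAdjMat G f f ≡ + 0
    loopless f rewrite ==-refl f = refl

  open Shift (lineAdjMat G)
  open Expansion (lineAdjMat G) Tr-lineAdj hiding (t)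

  p-mixed : ∀ k → p (suc k) ≡ mixed (suc k) 0 - + 2 * Tr (odd (suc k))
  p-mixed k = trans (Tr-laplacian (suc k))
    (cong (_- + 2 * Tr (odd (suc k))) (trans (Tr-signless k) (Tr-shift (suc k))))

  p-mixed-0 : ∀ k → Tr (odd (suc k)) ≡ + 0 → p (suc k) ≡ mixed (suc k) 0
  p-mixed-0 k eq = trans (p-mixed k) (trans (cong (λ x → mixed (suc k) 0 - + 2 * x) eq) (ℤ.+-identityʳ (mixed (suc k) 0)))

  mixed₁ : mixed 1 0 ≡ trA G 2
  mixed₁ = trans (sym (trans (Tr-signless 0) (Tr-shift 1))) Tr-signless₁

  p₁≡ : p 1 ≡ trA G 2
  p₁≡ = trans (p-mixed-0 0 Tr-odd₁) mixed₁

  p₂≡ : p 2 ≡ powerSum₂ (trA G 2) (trA₁ G 2)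
  p₂≡ = trans (p-mixed-0 1 Tr-odd₂) (trans Tr-shift₂ (cong (λ t → powerSum₂ t (trA₁ G 2)) mixed₁))

  p₃≡ : p 3 ≡ powerSum₃ (trA G 2) (trA₁ G 2) (trA₁ G 3) - + 2 * trA G 3
  p₃≡ = trans (p-mixed 2) (cong₂ (λ x y → x - + 2 * y)
    (trans Tr-shift₃ (cong (λ t → powerSum₃ t (trA₁ G 2) (trA₁ G 3)) mixed₁)) Tr-odd₃)

  c₁≡ : 1 ≤ n → c G (n ∸ 1) ≡ trA G 2
  c₁≡ le = trans (newton₁ le) p₁≡

  c₂≡ : 2 ≤ n → + 2 * c G (n ∸ 2) ≡ elementary₂ (trA G 2) (trA₁ G 2)
  c₂≡ le = trans (newton₂ le)
    (trans (cong₂ _-_ (cong₂ _*_ (c₁≡ (ℕ.m+n≤o⇒m≤o 1 le)) p₁≡) p₂≡) (recurrence₂ (trA G 2) (trA₁ G 2)))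

  c₃≡ : 3 ≤ n → + 6 * c G (n ∸ 3) ≡ elementary₃ (trA G 2) (trA₁ G 2) (trA₁ G 3) - + 4 * trA G 3
  c₃≡ le = trans (newton-scaled₃ {c₁ = c G (n ∸ 1)} {c₂ = c G (n ∸ 2)} {c₃ = c G (n ∸ 3)} {x₁ = p 1} {x₂ = p 2} {x₃ = p 3}
      (newton₃ le) (c₂≡ (ℕ.m+n≤o⇒m≤o 2 le)) (c₁≡ (ℕ.m+n≤o⇒m≤o 1 le)) p₁≡ p₂≡ p₃≡)
    (trans (ring (trA G 2 * elementary₂ (trA G 2) (trA₁ G 2) - + 2 * powerSum₂ (trA G 2) (trA₁ G 2) * trA G 2)
                 (powerSum₃ (trA G 2) (trA₁ G 2) (trA₁ G 3)) (trA G 3))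
           (cong (_- + 4 * trA G 3) (recurrence₃ (trA G 2) (trA₁ G 2) (trA₁ G 3))))
    where
    ring : ∀ x p t → x + + 2 * (p - + 2 * t) ≡ (x + + 2 * p) - + 4 * t
    ring = solve-∀

  module _ (acyclic : Forest G) where

    p-forest : ∀ k → p (suc k) ≡ mixed (suc k) 0
    p-forest k = p-mixed-0 k (Tr-odd acyclic (suc k))

    trA₃≡0 : trA G 3 ≡ + 0
    trA₃≡0 = trans (sym Tr-odd₃) (Tr-odd acyclic 3)

    p₃-forest : p 3 ≡ powerSum₃ (trA G 2) (trA₁ G 2) (trA₁ G 3)
    p₃-forest = trans (p-forest 2) (trans Tr-shift₃ (cong (λ t → powerSum₃ t (trA₁ G 2) (trA₁ G 3)) mixed₁))

    p₄≡ : p 4 ≡ powerSum₄ (trA G 2) (trA₁ G 2) (trA₁ G 3) (trA₁ G 4)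
    p₄≡ = trans (p-forest 3) (trans Tr-shift₄ (cong (λ t → powerSum₄ t (trA₁ G 2) (trA₁ G 3) (trA₁ G 4)) mixed₁))

    p₅≡ : p 5 ≡ powerSum₅ (trA G 2) (trA₁ G 2) (trA₁ G 3) (trA₁ G 4) (trA₁ G 5)
    p₅≡ = trans (p-forest 4) (trans Tr-shift₅ (cong (λ t → powerSum₅ t (trA₁ G 2) (trA₁ G 3) (trA₁ G 4) (trA₁ G 5)) mixed₁))

    p₆≡ : p 6 ≡ powerSum₆ (trA G 2) (trA₁ G 2) (trA₁ G 3) (trA₁ G 4) (trA₁ G 5) (trA₁ G 6)
    p₆≡ = trans (p-forest 5) (trans Tr-shift₆ (cong (λ t → powerSum₆ t (trA₁ G 2) (trA₁ G 3) (trA₁ G 4) (trA₁ G 5) (trA₁ G 6)) mixed₁))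

    c₃-forest : 3 ≤ n → + 6 * c G (n ∸ 3) ≡ elementary₃ (trA G 2) (trA₁ G 2) (trA₁ G 3)
    c₃-forest le = trans (c₃≡ le)
      (trans (cong (λ x → elementary₃ (trA G 2) (trA₁ G 2) (trA₁ G 3) - + 4 * x) trA₃≡0) (ℤ.+-identityʳ (elementary₃ (trA G 2) (trA₁ G 2) (trA₁ G 3))))

    c₄≡ : 4 ≤ n → + 24 * c G (n ∸ 4) ≡ elementary₄ (trA G 2) (trA₁ G 2) (trA₁ G 3) (trA₁ G 4)
    c₄≡ le = newton-elementary₄ (λ i → c G (n ∸ i)) p (trA₁ G) (trA G 2) (newton₄ le)
      (c₃-forest (ℕ.m+n≤o⇒m≤o 3 le)) (c₂≡ (ℕ.m+n≤o⇒m≤o 2 le)) (c₁≡ (ℕ.m+n≤o⇒m≤o 1 le))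
      p₁≡ p₂≡ p₃-forest p₄≡

    c₅≡ : 5 ≤ n → + 120 * c G (n ∸ 5) ≡ elementary₅ (trA G 2) (trA₁ G 2) (trA₁ G 3) (trA₁ G 4) (trA₁ G 5)
    c₅≡ le = newton-elementary₅ (λ i → c G (n ∸ i)) p (trA₁ G) (trA G 2) (newton₅ le)
      (c₄≡ (ℕ.m+n≤o⇒m≤o 4 le)) (c₃-forest (ℕ.m+n≤o⇒m≤o 3 le)) (c₂≡ (ℕ.m+n≤o⇒m≤o 2 le)) (c₁≡ (ℕ.m+n≤o⇒m≤o 1 le))
      p₁≡ p₂≡ p₃-forest p₄≡ p₅≡

    c₆≡ : 6 ≤ n → + 720 * c G (n ∸ 6) ≡ elementary₆ (trA G 2) (trA₁ G 2) (trA₁ G 3) (trA₁ G 4) (trA₁ G 5) (trA₁ G 6)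
    c₆≡ le = newton-elementary₆ (λ i → c G (n ∸ i)) p (trA₁ G) (trA G 2) (newton₆ le)
      (c₅≡ (ℕ.m+n≤o⇒m≤o 5 le)) (c₄≡ (ℕ.m+n≤o⇒m≤o 4 le)) (c₃-forest (ℕ.m+n≤o⇒m≤o 3 le)) (c₂≡ (ℕ.m+n≤o⇒m≤o 2 le)) (c₁≡ (ℕ.m+n≤o⇒m≤o 1 le))
      p₁≡ p₂≡ p₃-forest p₄≡ p₅≡ p₆≡

theorem3p5 : ∀ {n} (G : Graph n) →
  let t2 = trA G 2
      t3 = trA G 3
      s2 = trA₁ G 2
      s3 = trA₁ G 3
      s4 = trA₁ G 4
      s5 = trA₁ G 5
      s6 = trA₁ G 6
  in
  -- (1)
  (1 ≤ n → c G (n ∸ 1) ≡ t2)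
  × (2 ≤ n → + 2 * c G (n ∸ 2) ≡ fallProd t2 2 - s2)
  -- (2)
  × (3 ≤ n → + 6 * c G (n ∸ 3) ≡
       fallProd t2 3 - + 3 * t2 * s2 + (+ 12 * s2 + + 2 * s3) - + 4 * t3)
  -- (3)
  × (Forest G → 4 ≤ n → + 24 * c G (n ∸ 4) ≡
       fallProd t2 4 - + 6 * (t2 * t2) * s2 + t2 * (+ 60 * s2 + + 8 * s3)
       - (+ 144 * s2 + + 48 * s3 + + 6 * s4) + + 3 * (s2 * s2))
  -- (4)
  × (Forest G → 5 ≤ n → + 120 * c G (n ∸ 5) ≡
       fallProd t2 5 - + 10 * (t2 * t2 * t2) * s2
       + (t2 * t2) * (+ 180 * s2 + + 20 * s3)
       - t2 * (+ 1040 * s2 + + 280 * s3 + + 30 * s4)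
       + + 15 * t2 * (s2 * s2)
       - s2 * (+ 120 * s2 + + 20 * s3)
       + (+ 1920 * s2 + + 960 * s3 + + 240 * s4 + + 24 * s5))
  -- (5)  (sign typo of the source corrected, see NOTES.md)
  × (Forest G → 6 ≤ n → + 720 * c G (n ∸ 6) ≡
       fallProd t2 6 - + 15 * (t2 * t2 * t2 * t2) * s2
       + (t2 * t2 * t2) * (+ 420 * s2 + + 40 * s3)
       - (t2 * t2) * (+ 4260 * s2 + + 960 * s3 + + 90 * s4)
       + + 45 * ((t2 * s2) * (t2 * s2))
       - + 810 * t2 * (s2 * s2)
       + t2 * (+ 18480 * s2 + + 7520 * s3 + + 1620 * s4 + + 144 * s5)
       - + 15 * (s2 * s2 * s2)
       + + 3600 * (s2 * s2)
       - + 28800 * s2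
       + s2 * (+ 1200 * s3 + + 90 * s4)
       + + 40 * (s3 * s3)
       - + 120 * t2 * s2 * s3
       - (+ 19200 * s3 + + 7200 * s4 + + 1440 * s5 + + 120 * s6))
theorem3p5 G = c₁≡ , c₂≡ , c₃≡
  , (λ acyclic le → trans (c₄≡ acyclic le)
      (elementary₄-unfold (trA G 2) (trA₁ G 2) (trA₁ G 3) (trA₁ G 4)))
  , (λ acyclic le → trans (c₅≡ acyclic le)
      (elementary₅-unfold (trA G 2) (trA₁ G 2) (trA₁ G 3) (trA₁ G 4) (trA₁ G 5)))
  , (λ acyclic le → trans (c₆≡ acyclic le)
      (elementary₆-unfold (trA G 2) (trA₁ G 2) (trA₁ G 3) (trA₁ G 4) (trA₁ G 5) (trA₁ G 6)))
  where open Coefficients G
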